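{- Let $S\subseteq\{0,1\}^n$, $f\in[0,1/2]$, $m>0$, $T>0$ integers, and let $h_m^1,\dots,h_m^T$ be hash functions sampled independently from $\mathcal{H}^f_{m\times n}$. Let $Y_k=\mathbb{I}[S(h_m^k)\ge1]$, $Y=\sum_{k=1}^T Y_k$, and $\Pr_{\mathrm{est}}[S(h)\ge1]=Y/T$. Let $\kappa>0$ and $c>0$. Define the random variable $\mathcal{B}$ to equal $\frac{2^m c}{1+\kappa}$ if $\Pr_{\mathrm{est}}[S(h)\ge1]\ge c$, and $0$ otherwise. Then $$\Pr\left[|S|\ge\mathcal{B}\right]\ge 1-\exp\left(-\frac{\kappa^2cT}{(1+\kappa)(2+\kappa)}\right).$$
   Context: For integers $1\le m\le n$ and $f\in[0,1/2]$, sampling $h$ from $\mathcal{H}^f_{m\times n}$ means $h(x)=Ax+b\bmod 2$ with $A\in\{0,1\}^{m\times n}$ having i.i.d. entries with $\Pr[A_{ij}=1]=f$ and $b\in\{0,1\}^m$ uniform and independent of $A$. For $S\subseteq\{0,1\}^n$, $S(h)=|\{x\in S:h(x)=0\}|$. -}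

module Defs where

open import Algebra.Bundles using (CommutativeRing)
open import Algebra.Core using (Op₁; Op₂)
open import Algebra.Structures using (IsCommutativeRing)
open import Data.Bool.Base using (if_then_else_)
open import Data.Fin.Base using (Fin; toℕ)
open import Data.Fin.Patterns using (0F; 1F)
import Data.Fin.Properties as Fin
open import Data.List.Base as List using (List; []; _∷_)
open import Data.Nat.Base as ℕ using (ℕ; zero; suc; z≤n; s≤s; _!)
open import Data.Nat.DivMod using (_mod_)
import Data.Nat.Properties as ℕ
open import Data.Product.Base using (∃; _×_; _,_; proj₁; proj₂; map₂)
open import Data.Sum.Base using (inj₁; inj₂; [_,_]′)
open import Data.Vec.Base as Vec using (Vec; []; _∷_)
import Data.Vec.Properties as Vec
open import Level as Level using (Level) renaming (_⊔_ to _⊔ˡ_)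
open import Relation.Binary.Bundles using (DecTotalOrder)
open import Relation.Binary.Core using (Rel)
open import Relation.Binary.Structures using (IsDecTotalOrder)
open import Relation.Nullary using (¬_; does; contradiction)
open import Relation.Nullary.Decidable using (_×-dec_)
open import Relation.Unary using (Pred; Decidable)

record OrderedField c ℓ₁ ℓ₂ : Set (Level.suc (c ⊔ˡ ℓ₁ ⊔ˡ ℓ₂)) where
  infix  9 _⁻¹
  infix  8 -_
  infixl 7 _*_
  infixl 6 _+_
  infix  4 _≈_ _≤_
  field
    Carrier           : Set c
    _≈_               : Rel Carrier ℓ₁
    _≤_               : Rel Carrier ℓ₂
    _+_ _*_           : Op₂ Carrier
    -_ _⁻¹            : Op₁ Carrier
    0# 1#             : Carrier
    isCommutativeRing : IsCommutativeRing _≈_ _+_ _*_ -_ 0# 1#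
    isDecTotalOrder   : IsDecTotalOrder _≈_ _≤_
    1≉0               : ¬ 1# ≈ 0#
    -- The value of 0# ⁻¹ is left unspecified.
    ⁻¹-cong           : ∀ {x y} → x ≈ y → x ⁻¹ ≈ y ⁻¹
    *-inverseʳ        : ∀ {x} → ¬ x ≈ 0# → x * x ⁻¹ ≈ 1#
    +-monoˡ-≤         : ∀ {x y} z → x ≤ y → x + z ≤ y + z
    *-nonNeg          : ∀ {x y} → 0# ≤ x → 0# ≤ y → 0# ≤ x * y

  commutativeRing : CommutativeRing c ℓ₁
  commutativeRing = record { isCommutativeRing = isCommutativeRing }

  decTotalOrder : DecTotalOrder c ℓ₁ ℓ₂
  decTotalOrder = record { isDecTotalOrder = isDecTotalOrder }

  open CommutativeRing commutativeRing public
    hiding (Carrier; _≈_; _+_; _*_; -_; 0#; 1#; isCommutativeRing)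
  open DecTotalOrder decTotalOrder public
    using (_≥_; _≤?_; totalOrder)
    renaming ( refl to ≤-refl; reflexive to ≤-reflexive; trans to ≤-trans
             ; antisym to ≤-antisym; total to ≤-total; ≤-respʳ-≈ to ≤-respʳ
             ; ≤-respˡ-≈ to ≤-respˡ )
  open import Relation.Binary.Properties.DecTotalOrder decTotalOrder public
    using (_<_; ≰⇒>; ≮⇒≥; <⇒≱; ≤⇒≯)
  open import Algebra.Construct.NaturalChoice.Max totalOrder public
    using (_⊔_)
  open import Algebra.Properties.Semiring.Exp semiring public
    using (_^_)
  import Algebra.Properties.Semiring.Mult semiring as Mult

  infixl 7 _/_
  _/_ : Op₂ Carrier
  x / y = x * y ⁻¹

  fromℕ : ℕ → Carrier
  fromℕ n = n Mult.× 1#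

  ∣_∣ : Op₁ Carrier
  ∣ x ∣ = x ⊔ (- x)

  Cauchy : (ℕ → Carrier) → Set (c ⊔ˡ ℓ₁ ⊔ˡ ℓ₂)
  Cauchy s = ∀ ε → 0# < ε → ∃ λ N → ∀ m n → N ℕ.≤ m → N ℕ.≤ n → ∣ s m - s n ∣ < ε

  _⟶_ : (ℕ → Carrier) → Carrier → Set (c ⊔ˡ ℓ₁ ⊔ˡ ℓ₂)
  s ⟶ l = ∀ ε → 0# < ε → ∃ λ N → ∀ n → N ℕ.≤ n → ∣ s n - l ∣ < ε

  partialSum : (ℕ → Carrier) → ℕ → Carrier
  partialSum u zero    = 0#
  partialSum u (suc n) = partialSum u n + u n

-- Classically, ℝ is up to isomorphism the only Archimedean Cauchy-complete
-- ordered field, so quantifying over all of these is speaking about ℝ.  The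
-- order is decidable (constructing an instance therefore takes a classical
-- axiom), which is what allows random variables to be defined by cases on it.
record RealField c ℓ₁ ℓ₂ : Set (Level.suc (c ⊔ˡ ℓ₁ ⊔ˡ ℓ₂)) where
  field
    orderedField : OrderedField c ℓ₁ ℓ₂
  open OrderedField orderedField public
  field
    archimedean  : ∀ x → ∃ λ n → x ≤ fromℕ n
    complete     : ∀ s → Cauchy s → ∃ λ l → s ⟶ l

module OrderedFieldProperties {c ℓ₁ ℓ₂} (F : OrderedField c ℓ₁ ℓ₂) where
  open OrderedField F
  open import Algebra.Construct.NaturalChoice.Max totalOrder
    using (⊔-lub; x≤x⊔y; x≤y⊔x)
  open import Algebra.Properties.AbelianGroup +-abelianGroup
    using (⁻¹-∙-comm; ⁻¹-anti-homo‿-; //-rightDividesʳ)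
    renaming (⁻¹-involutive to -‿involutive; ε⁻¹≈ε to -0≈0)
  open import Algebra.Properties.CommutativeSemigroup +-commutativeSemigroup
    using (interchange)
  open import Algebra.Properties.CommutativeSemigroup *-commutativeSemigroup
    using () renaming (interchange to *-interchange)
  open import Algebra.Properties.Ring ring using (-‿distribˡ-*; -‿distribʳ-*)
  open import Algebra.Properties.Semiring.Mult semiring using (×1-homo-*)
  open import Relation.Binary.Reasoning.PartialOrder
    (DecTotalOrder.poset decTotalOrder)

  +-monoʳ-≤ : ∀ {x y} z → x ≤ y → z + x ≤ z + y
  +-monoʳ-≤ {x} {y} z x≤y = begin
    z + x  ≈⟨ +-comm z x ⟩
    x + z  ≤⟨ +-monoˡ-≤ z x≤y ⟩
    y + z  ≈⟨ +-comm y z ⟩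
    z + y  ∎

  +-mono-≤ : ∀ {x y u v} → x ≤ y → u ≤ v → x + u ≤ y + v
  +-mono-≤ x≤y u≤v = ≤-trans (+-monoˡ-≤ _ x≤y) (+-monoʳ-≤ _ u≤v)

  x≤y⇒0≤y-x : ∀ {x y} → x ≤ y → 0# ≤ y - x
  x≤y⇒0≤y-x {x} {y} x≤y = begin
    0#     ≈⟨ -‿inverseʳ x ⟨
    x - x  ≤⟨ +-monoˡ-≤ (- x) x≤y ⟩
    y - x  ∎

  0≤y-x⇒x≤y : ∀ {x y} → 0# ≤ y - x → x ≤ y
  0≤y-x⇒x≤y {x} {y} 0≤y-x = begin
    x              ≈⟨ +-identityˡ x ⟨
    0# + x         ≤⟨ +-monoˡ-≤ x 0≤y-x ⟩
    (y - x) + x    ≈⟨ +-assoc y (- x) x ⟩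
    y + (- x + x)  ≈⟨ +-congˡ (-‿inverseˡ x) ⟩
    y + 0#         ≈⟨ +-identityʳ y ⟩
    y              ∎

  neg-antimono-≤ : ∀ {x y} → x ≤ y → - y ≤ - x
  neg-antimono-≤ {x} {y} x≤y = 0≤y-x⇒x≤y (begin
    0#           ≤⟨ x≤y⇒0≤y-x x≤y ⟩
    y - x        ≈⟨ +-comm y (- x) ⟩
    - x + y      ≈⟨ +-congˡ (-‿involutive y) ⟨
    - x - (- y)  ∎)

  x≤0⇒0≤-x : ∀ {x} → x ≤ 0# → 0# ≤ - x
  x≤0⇒0≤-x {x} x≤0 = ≤-respʳ (+-identityˡ (- x)) (x≤y⇒0≤y-x x≤0)

  *-monoˡ-≤ : ∀ {x y z} → 0# ≤ z → x ≤ y → x * z ≤ y * z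
  *-monoˡ-≤ {x} {y} {z} 0≤z x≤y = 0≤y-x⇒x≤y (begin
    0#                ≤⟨ *-nonNeg (x≤y⇒0≤y-x x≤y) 0≤z ⟩
    (y - x) * z       ≈⟨ distribʳ z y (- x) ⟩
    y * z + - x * z   ≈⟨ +-congˡ (-‿distribˡ-* x z) ⟨
    y * z - x * z     ∎)

  *-monoʳ-≤ : ∀ {x y z} → 0# ≤ z → x ≤ y → z * x ≤ z * y
  *-monoʳ-≤ {x} {y} {z} 0≤z x≤y = begin
    z * x  ≈⟨ *-comm z x ⟩
    x * z  ≤⟨ *-monoˡ-≤ 0≤z x≤y ⟩
    y * z  ≈⟨ *-comm y z ⟩
    z * y  ∎

  -x*-y≈x*y : ∀ x y → - x * - y ≈ x * y
  -x*-y≈x*y x y = begin-equality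
    - x * - y      ≈⟨ -‿distribˡ-* x (- y) ⟨
    - (x * - y)    ≈⟨ -‿cong (-‿distribʳ-* x y) ⟨
    - - (x * y)    ≈⟨ -‿involutive (x * y) ⟩
    x * y          ∎

  0≤1 : 0# ≤ 1#
  0≤1 with ≤-total 0# 1#
  ... | inj₁ 0≤1 = 0≤1
  ... | inj₂ 1≤0 = begin
    0#           ≤⟨ *-nonNeg (x≤0⇒0≤-x 1≤0) (x≤0⇒0≤-x 1≤0) ⟩
    - 1# * - 1#  ≈⟨ -x*-y≈x*y 1# 1# ⟩
    1# * 1#      ≈⟨ *-identityʳ 1# ⟩
    1#           ∎

  0≤fromℕ : ∀ n → 0# ≤ fromℕ n
  0≤fromℕ zero    = ≤-refl
  0≤fromℕ (suc n) = ≤-respˡ (+-identityʳ 0#) (+-mono-≤ 0≤1 (0≤fromℕ n))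

  1≤fromℕ : ∀ n → 1# ≤ fromℕ (suc n)
  1≤fromℕ n = ≤-respˡ (+-identityʳ 1#) (+-monoʳ-≤ 1# (0≤fromℕ n))

  fromℕ-mono : ∀ {m n} → m ℕ.≤ n → fromℕ m ≤ fromℕ n
  fromℕ-mono {n = n} z≤n = 0≤fromℕ n
  fromℕ-mono (s≤s m≤n)   = +-monoʳ-≤ 1# (fromℕ-mono m≤n)

  1≤x⇒x≉0 : ∀ {x} → 1# ≤ x → ¬ x ≈ 0#
  1≤x⇒x≉0 1≤x x≈0 = 1≉0 (≤-antisym (≤-respʳ x≈0 1≤x) 0≤1)

  0≤x⁻¹ : ∀ {x} → ¬ x ≈ 0# → 0# ≤ x → 0# ≤ x ⁻¹
  0≤x⁻¹ {x} x≉0 0≤x with ≤-total 0# (x ⁻¹)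
  ... | inj₁ 0≤x⁻¹ = 0≤x⁻¹
  ... | inj₂ x⁻¹≤0 = contradiction (≤-antisym 1≤0 0≤1) 1≉0
    where
    1≤0 : 1# ≤ 0#
    1≤0 = begin
      1#        ≈⟨ *-inverseʳ x≉0 ⟨
      x * x ⁻¹  ≤⟨ *-monoʳ-≤ 0≤x x⁻¹≤0 ⟩
      x * 0#    ≈⟨ zeroʳ x ⟩
      0#        ∎

  ⁻¹-distrib-* : ∀ {x y} → ¬ x ≈ 0# → ¬ y ≈ 0# → ¬ x * y ≈ 0# →
                 (x * y) ⁻¹ ≈ x ⁻¹ * y ⁻¹
  ⁻¹-distrib-* {x} {y} x≉0 y≉0 xy≉0 = begin-equality
    (x * y) ⁻¹                            ≈⟨ *-identityʳ _ ⟨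
    (x * y) ⁻¹ * 1#                       ≈⟨ *-congˡ (*-identityʳ 1#) ⟨
    (x * y) ⁻¹ * (1# * 1#)                ≈⟨ *-congˡ (*-cong (*-inverseʳ x≉0) (*-inverseʳ y≉0)) ⟨
    (x * y) ⁻¹ * (x / x * (y / y))        ≈⟨ *-congˡ (*-interchange _ _ _ _) ⟩
    (x * y) ⁻¹ * (x * y * (x ⁻¹ * y ⁻¹))  ≈⟨ *-assoc _ _ _ ⟨
    (x * y) ⁻¹ * (x * y) * (x ⁻¹ * y ⁻¹)  ≈⟨ *-congʳ (*-comm _ _) ⟩
    x * y / (x * y) * (x ⁻¹ * y ⁻¹)       ≈⟨ *-congʳ (*-inverseʳ xy≉0) ⟩
    1# * (x ⁻¹ * y ⁻¹)                    ≈⟨ *-identityˡ _ ⟩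
    x ⁻¹ * y ⁻¹                           ∎

  x≤∣x∣ : ∀ x → x ≤ ∣ x ∣
  x≤∣x∣ x = x≤x⊔y x (- x)

  -x≤∣x∣ : ∀ x → - x ≤ ∣ x ∣
  -x≤∣x∣ x = x≤y⊔x x (- x)

  0≤∣x∣ : ∀ x → 0# ≤ ∣ x ∣
  0≤∣x∣ x = [ (λ 0≤x → ≤-trans 0≤x (x≤∣x∣ x))
           , (λ x≤0 → ≤-trans (x≤0⇒0≤-x x≤0) (-x≤∣x∣ x)) ]′ (≤-total 0# x)

  module _ {u v a b} (u≤a : u ≤ a) (-u≤a : - u ≤ a) (v≤b : v ≤ b) (-v≤b : - v ≤ b)
           (0≤b : 0# ≤ b) where

    *-bound : u * v ≤ a * b
    *-bound with ≤-total 0# u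
    ... | inj₁ 0≤u = ≤-trans (*-monoʳ-≤ 0≤u v≤b) (*-monoˡ-≤ 0≤b u≤a)
    ... | inj₂ u≤0 = begin
      u * v      ≈⟨ -x*-y≈x*y u v ⟨
      - u * - v  ≤⟨ *-monoʳ-≤ (x≤0⇒0≤-x u≤0) -v≤b ⟩
      - u * b    ≤⟨ *-monoˡ-≤ 0≤b -u≤a ⟩
      a * b      ∎

  expTerm : Carrier → ℕ → Carrier
  expTerm x k = x ^ k / fromℕ (k !)

  fromℕ-suc≉0 : ∀ k → ¬ fromℕ (suc k) ≈ 0#
  fromℕ-suc≉0 k = 1≤x⇒x≉0 (1≤fromℕ k)

  fromℕ!≉0 : ∀ k → ¬ fromℕ (k !) ≈ 0#
  fromℕ!≉0 k = 1≤x⇒x≉0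
    (≤-trans (1≤fromℕ 0) (fromℕ-mono (ℕ.1≤n! k)))

  expTerm-suc : ∀ x k → expTerm x (suc k) ≈ expTerm x k * (x / fromℕ (suc k))
  expTerm-suc x k = begin-equality
    x * x ^ k * fromℕ (suc k ℕ.* k !) ⁻¹
      ≈⟨ *-congˡ (⁻¹-cong (×1-homo-* (suc k) (k !))) ⟩
    x * x ^ k * (fromℕ (suc k) * fromℕ (k !)) ⁻¹
      ≈⟨ *-congˡ (⁻¹-distrib-* (fromℕ-suc≉0 k) (fromℕ!≉0 k)
           (λ eq → fromℕ!≉0 (suc k) (trans (×1-homo-* (suc k) (k !)) eq))) ⟩
    x * x ^ k * (fromℕ (suc k) ⁻¹ * fromℕ (k !) ⁻¹)
      ≈⟨ *-interchange _ _ _ _ ⟩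
    x / fromℕ (suc k) * expTerm x k
      ≈⟨ *-comm _ _ ⟩
    expTerm x k * (x / fromℕ (suc k))
      ∎

  0≤fromℕ-suc⁻¹ : ∀ k → 0# ≤ fromℕ (suc k) ⁻¹
  0≤fromℕ-suc⁻¹ k = 0≤x⁻¹ (fromℕ-suc≉0 k) (0≤fromℕ (suc k))

  module ExpSeries (x : Carrier) where

    t A : ℕ → Carrier
    t = expTerm x
    A = expTerm ∣ x ∣

    0≤∣x∣/k : ∀ k → 0# ≤ ∣ x ∣ / fromℕ (suc k)
    0≤∣x∣/k k = *-nonNeg (0≤∣x∣ x) (0≤fromℕ-suc⁻¹ k)

    0≤A : ∀ k → 0# ≤ A k
    0≤A zero    = *-nonNeg 0≤1 (0≤x⁻¹ (fromℕ!≉0 0) (0≤fromℕ 1))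
    0≤A (suc k) = ≤-respʳ (sym (expTerm-suc ∣ x ∣ k)) (*-nonNeg (0≤A k) (0≤∣x∣/k k))

    t-bound : ∀ k → t k ≤ A k × - t k ≤ A k
    t-bound zero    = ≤-refl , ≤-trans -t≤0 (0≤A 0)
      where
      -t≤0 : - t 0 ≤ 0#
      -t≤0 = begin
        - t 0  ≤⟨ neg-antimono-≤ (0≤A 0) ⟩
        - 0#   ≈⟨ -0≈0 ⟩
        0#     ∎
    t-bound (suc k) = upper , lower
      where
      r q : Carrier
      r = x / fromℕ (suc k)
      q = ∣ x ∣ / fromℕ (suc k)
      r≤q : r ≤ q
      r≤q = *-monoˡ-≤ (0≤fromℕ-suc⁻¹ k) (x≤∣x∣ x)
      -r≤q : - r ≤ q
      -r≤q = ≤-respˡ (sym (-‿distribˡ-* _ _)) (*-monoˡ-≤ (0≤fromℕ-suc⁻¹ k) (-x≤∣x∣ x))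
      upper : t (suc k) ≤ A (suc k)
      upper = begin
        t (suc k)  ≈⟨ expTerm-suc x k ⟩
        t k * r    ≤⟨ *-bound (proj₁ (t-bound k)) (proj₂ (t-bound k)) r≤q -r≤q (0≤∣x∣/k k) ⟩
        A k * q    ≈⟨ expTerm-suc ∣ x ∣ k ⟨
        A (suc k)  ∎
      lower : - t (suc k) ≤ A (suc k)
      lower = begin
        - t (suc k)  ≈⟨ -‿cong (expTerm-suc x k) ⟩
        - (t k * r)  ≈⟨ -‿distribʳ-* (t k) r ⟩
        t k * - r    ≤⟨ *-bound (proj₁ (t-bound k)) (proj₂ (t-bound k)) -r≤q
                          (≤-respˡ (sym (-‿involutive r)) r≤q) (0≤∣x∣/k k) ⟩
        A k * q      ≈⟨ expTerm-suc ∣ x ∣ k ⟨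
        A (suc k)    ∎

    module _ (K : ℕ) (2∣x∣≤K : ∣ x ∣ + ∣ x ∣ ≤ fromℕ K) where

      A-halves : ∀ {k} → K ℕ.≤ k → A (suc k) + A (suc k) ≤ A k
      A-halves {k} K≤k = begin
        A (suc k) + A (suc k)    ≈⟨ +-cong (expTerm-suc ∣ x ∣ k) (expTerm-suc ∣ x ∣ k) ⟩
        A k * q + A k * q        ≈⟨ distribˡ (A k) q q ⟨
        A k * (q + q)            ≈⟨ *-congˡ (distribʳ _ ∣ x ∣ ∣ x ∣) ⟨
        A k * ((∣ x ∣ + ∣ x ∣) / fromℕ (suc k))
          ≤⟨ *-monoʳ-≤ (0≤A k) (*-monoˡ-≤ (0≤fromℕ-suc⁻¹ k)
               (≤-trans 2∣x∣≤K (fromℕ-mono (ℕ.m≤n⇒m≤1+n K≤k)))) ⟩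
        A k * (fromℕ (suc k) / fromℕ (suc k))
          ≈⟨ *-congˡ (*-inverseʳ (fromℕ-suc≉0 k)) ⟩
        A k * 1#                 ≈⟨ *-identityʳ (A k) ⟩
        A k                      ∎
        where
        q : Carrier
        q = ∣ x ∣ / fromℕ (suc k)

      A-decay : ∀ j → fromℕ (suc j) * A (j ℕ.+ K) ≤ A K
      A-decay zero    = ≤-reflexive (trans (*-congʳ (+-identityʳ 1#)) (*-identityˡ (A K)))
      A-decay (suc j) = begin
        (1# + n) * a        ≈⟨ distribʳ a 1# n ⟩
        1# * a + n * a      ≤⟨ +-monoˡ-≤ (n * a) (*-monoˡ-≤ (0≤A (suc j ℕ.+ K)) (1≤fromℕ j)) ⟩
        n * a + n * a       ≈⟨ distribˡ n a a ⟨
        n * (a + a)         ≤⟨ *-monoʳ-≤ (0≤fromℕ (suc j)) (A-halves (ℕ.m≤n+m K j)) ⟩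
        n * A (j ℕ.+ K)     ≤⟨ A-decay j ⟩
        A K                 ∎
        where
        n a : Carrier
        n = fromℕ (suc j)
        a = A (suc j ℕ.+ K)

      module _ {s u : ℕ → Carrier} (s-suc : ∀ k → s (suc k) ≈ s k + u k)
               (u≤A : ∀ k → u k ≤ A k) where

        envelope : ∀ {N n} → K ℕ.≤ N → N ℕ.≤′ n → s n + (A n + A n) ≤ s N + (A N + A N)
        envelope K≤N ℕ.≤′-refl = ≤-refl
        envelope {N} {suc n} K≤N (ℕ.≤′-step N≤n) = begin
          s (suc n) + (A (suc n) + A (suc n))
            ≤⟨ +-mono-≤ (≤-respˡ (sym (s-suc n)) (+-monoʳ-≤ (s n) (u≤A n)))
                        (A-halves (ℕ.≤-trans K≤N (ℕ.≤′⇒≤ N≤n))) ⟩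
          (s n + A n) + A n    ≈⟨ +-assoc _ _ _ ⟩
          s n + (A n + A n)    ≤⟨ envelope K≤N N≤n ⟩
          s N + (A N + A N)    ∎

        s≤envelope : ∀ {N n} → K ℕ.≤ N → N ℕ.≤ n → s n ≤ s N + (A N + A N)
        s≤envelope {N} {n} K≤N N≤n = begin
          s n                ≈⟨ +-identityʳ (s n) ⟨
          s n + 0#           ≤⟨ +-monoʳ-≤ (s n) (≤-respˡ (+-identityʳ 0#) (+-mono-≤ (0≤A n) (0≤A n))) ⟩
          s n + (A n + A n)  ≤⟨ envelope K≤N (ℕ.≤⇒≤′ N≤n) ⟩
          s N + (A N + A N)  ∎

      s : ℕ → Carrier
      s = partialSum t

      4A : ℕ → Carrier
      4A N = (A N + A N) + (A N + A N)

      s-diff : ∀ {N m n} → K ℕ.≤ N → N ℕ.≤ m → N ℕ.≤ n → s m - s n ≤ 4A N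
      s-diff {N} {m} {n} K≤N N≤m N≤n = begin
        s m - s n
          ≤⟨ +-mono-≤ (s≤envelope {s} {t} (λ _ → refl) (λ k → proj₁ (t-bound k)) K≤N N≤m)
                      (s≤envelope {λ k → - s k} {λ k → - t k} (λ k → sym (⁻¹-∙-comm (s k) (t k)))
                        (λ k → proj₂ (t-bound k)) K≤N N≤n) ⟩
        (s N + 2A) + (- s N + 2A)  ≈⟨ interchange (s N) 2A (- s N) 2A ⟩
        (s N - s N) + 4A N         ≈⟨ +-congʳ (-‿inverseʳ (s N)) ⟩
        0# + 4A N                  ≈⟨ +-identityˡ (4A N) ⟩
        4A N                       ∎
        where
        2A : Carrier
        2A = A N + A N

      ∣s-diff∣ : ∀ {N m n} → K ℕ.≤ N → N ℕ.≤ m → N ℕ.≤ n → ∣ s m - s n ∣ ≤ 4A N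
      ∣s-diff∣ {N} {m} {n} K≤N N≤m N≤n = ⊔-lub (s-diff K≤N N≤m N≤n)
        (≤-respˡ (sym (⁻¹-anti-homo‿- (s m) (s n))) (s-diff K≤N N≤n N≤m))

      4A-decay : ∀ j → fromℕ (suc j) * 4A (j ℕ.+ K) ≤ 4A K
      4A-decay j = begin
        n * 4A (j ℕ.+ K)                           ≈⟨ distribˡ n _ _ ⟩
        n * (a + a) + n * (a + a)                  ≈⟨ +-cong (distribˡ n a a) (distribˡ n a a) ⟩
        (n * a + n * a) + (n * a + n * a)          ≤⟨ +-mono-≤ 2d 2d ⟩
        4A K                                       ∎
        where
        n a : Carrier
        n = fromℕ (suc j)
        a = A (j ℕ.+ K)
        2d : n * a + n * a ≤ A K + A K
        2d = +-mono-≤ (A-decay j) (A-decay j)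

      4A-small : ∀ {ε} j → 0# < ε → 4A K / ε ≤ fromℕ j → 4A (j ℕ.+ K) < ε
      4A-small {ε} j (0≤ε , 0≉ε) 4A/ε≤j = ≰⇒> λ ε≤4A → 0≉ε (≤-antisym 0≤ε (ε≤0 ε≤4A))
        where
        ε≉0 : ¬ ε ≈ 0#
        ε≉0 ε≈0 = 0≉ε (sym ε≈0)
        4A≤jε : 4A K ≤ fromℕ j * ε
        4A≤jε = begin
          4A K               ≈⟨ *-identityʳ _ ⟨
          4A K * 1#          ≈⟨ *-congˡ (*-inverseʳ ε≉0) ⟨
          4A K * (ε * ε ⁻¹)  ≈⟨ *-congˡ (*-comm ε (ε ⁻¹)) ⟩
          4A K * (ε ⁻¹ * ε)  ≈⟨ *-assoc _ _ _ ⟨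
          4A K / ε * ε       ≤⟨ *-monoˡ-≤ 0≤ε 4A/ε≤j ⟩
          fromℕ j * ε        ∎
        ε≤0 : ε ≤ 4A (j ℕ.+ K) → ε ≤ 0#
        ε≤0 ε≤4A = begin
          ε                                ≈⟨ //-rightDividesʳ (fromℕ j * ε) ε ⟨
          (ε + fromℕ j * ε) - fromℕ j * ε  ≈⟨ +-congʳ (+-congʳ (*-identityˡ ε)) ⟨
          (1# * ε + fromℕ j * ε) - fromℕ j * ε  ≈⟨ +-congʳ (distribʳ ε 1# (fromℕ j)) ⟨
          fromℕ (suc j) * ε - fromℕ j * ε
            ≤⟨ +-monoˡ-≤ _ (≤-trans (*-monoʳ-≤ (0≤fromℕ (suc j)) ε≤4A)
                 (≤-trans (4A-decay j) 4A≤jε)) ⟩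
          fromℕ j * ε - fromℕ j * ε      ≈⟨ -‿inverseʳ _ ⟩
          0#                             ∎

module Exponential {c ℓ₁ ℓ₂} (ℝ : RealField c ℓ₁ ℓ₂) where
  open RealField ℝ
  open OrderedFieldProperties orderedField
  open import Relation.Binary.Construct.NonStrictToStrict _≈_ _≤_ using (≤-<-trans)

  expSeries-cauchy : ∀ x → Cauchy (partialSum (λ k → x ^ k / fromℕ (k !)))
  expSeries-cauchy x ε 0<ε =
    let open ExpSeries x
        K , 2∣x∣≤K = archimedean (∣ x ∣ + ∣ x ∣)
        j , bound  = archimedean (4A K 2∣x∣≤K K / ε)
    in j ℕ.+ K , λ m n N≤m N≤n →
         ≤-<-trans ≤-trans ≤-antisym ≤-respˡ (∣s-diff∣ K 2∣x∣≤K (ℕ.m≤n+m K j) N≤m N≤n)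
                   (4A-small K 2∣x∣≤K j 0<ε bound)

  exp : Op₁ Carrier
  exp x = proj₁ (complete _ (expSeries-cauchy x))

  exp-converges : ∀ x → partialSum (λ k → x ^ k / fromℕ (k !)) ⟶ exp x
  exp-converges x = proj₂ (complete _ (expSeries-cauchy x))

private
  variable
    a b p : Level

Bit : Set
Bit = Fin 2

Bits : ℕ → Set
Bits = Vec Bit

-- An m × n matrix is the vector of its m rows.
Matrix : ℕ → ℕ → Set
Matrix m n = Vec (Bits n) m

Hash : ℕ → ℕ → Set
Hash m n = Bits n → Bits m

_∙_ : ∀ {n} → Bits n → Bits n → ℕ
u ∙ v = Vec.sum (Vec.zipWith (λ uⱼ vⱼ → toℕ uⱼ ℕ.* toℕ vⱼ) u v)

affine : ∀ {m n} → Matrix m n → Bits m → Hash m n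
affine A b x = Vec.zipWith (λ row bᵢ → ((row ∙ x) ℕ.+ toℕ bᵢ) mod 2) A b

allBits : ∀ n → List (Bits n)
allBits zero    = [] ∷ []
allBits (suc n) = List.cartesianProductWith _∷_ (0F ∷ 1F ∷ []) (allBits n)

card : ∀ {n} {S : Pred (Bits n) p} → Decidable S → ℕ
card {n = n} S? = List.length (List.filter S? (allBits n))

countZeros : ∀ {m n} {S : Pred (Bits n) p} → Decidable S → Hash m n → ℕ
countZeros {m = m} S? h = card λ x → S? x ×-dec (Vec.≡-dec Fin._≟_ (h x) (Vec.replicate m 0F))

module HashCounting {c ℓ₁ ℓ₂} (ℝ : RealField c ℓ₁ ℓ₂) where
  open RealField ℝ public
  open Exponential ℝ public using (exp)

  2# ½ : Carrier
  2# = 1# + 1#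
  ½  = 1# / 2#

  -- A finitely supported distribution: outcomes with their probabilities,
  -- where an outcome may be listed several times.
  Dist : Set a → Set (a ⊔ˡ c)
  Dist X = List (X × Carrier)

  return : {X : Set a} → X → Dist X
  return x = (x , 1#) ∷ []

  infixl 1 _>>=_
  _>>=_ : {X : Set a} {Y : Set b} → Dist X → (X → Dist Y) → Dist Y
  d >>= k = List.concatMap (λ (x , p) → List.map (map₂ (p *_)) (k x)) d

  Pr : {X : Set a} {P : Pred X p} → Dist X → Decidable P → Carrier
  Pr []            P? = 0#
  Pr ((x , p) ∷ d) P? = (if does (P? x) then p else 0#) + Pr d P?

  bernoulli : Carrier → Dist Bit
  bernoulli f = (1F , f) ∷ (0F , 1# - f) ∷ []

  iid : {X : Set a} → ∀ n → Dist X → Dist (Vec X n)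
  iid zero    d = return []
  iid (suc n) d = do
    x  ← d
    xs ← iid n d
    return (x ∷ xs)

  ℋ : Carrier → ∀ m n → Dist (Hash m n)
  ℋ f m n = do
    A ← iid m (iid n (bernoulli f))
    b ← iid m (bernoulli ½)
    return (affine A b)

  module _ {m n T : ℕ} {S : Pred (Bits n) p} (S? : Decidable S) where

    Y : Vec (Hash m n) T → ℕ
    Y hs = Vec.sum (Vec.map (λ h → if does (1 ℕ.≤? countZeros S? h) then 1 else 0) hs)

    Pr-est : Vec (Hash m n) T → Carrier
    Pr-est hs = fromℕ (Y hs) / fromℕ T

    ℬ : (κ c : Carrier) → Vec (Hash m n) T → Carrier
    ℬ κ c hs = if does (c ≤? Pr-est hs) then 2# ^ m * c / (1# + κ) else 0#

{-# OPTIONS --safe #-}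

-- Since b is uniform, h(x) is uniform for every x, so by Markov's inequality
-- p = Pr[S(h) ≥ 1] ≤ E[S(h)] = |S|/2ᵐ.  The bound can therefore only fail if
-- p ≤ q = c/(1+κ), and then only if Y ≥ cT, which is (1+κ) times the bound qT
-- on the mean of Y.  A Chernoff argument applies: with t = 2κ/(2+κ) one has
-- eᵗ ≤ 1+κ, so Y ≥ cT implies 1 ≤ e^(t(Y−cT)) ≤ (1+κ)^Y e^(−tcT), while
-- E[(1+κ)^Y] = (1+κp)ᵀ ≤ e^(κqT).  The resulting exponent κqT − tcT is exactly
-- −κ²cT/((1+κ)(2+κ)).  Taking t = 2κ/(2+κ) instead of the optimal ln(1+κ)
-- avoids logarithms without any loss in the stated bound.
module Submission where

open import Defs
open import Algebra.Bundles using (CommutativeRing)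
open import Data.Bool.Base using (Bool; true; false; _∧_; if_then_else_)
open import Data.Fin.Base using (toℕ)
open import Data.Fin.Patterns using (0F; 1F)
import Data.Fin.Properties as Fin
open import Data.Integer.Base as ℤ using (ℤ; -[1+_]; 0ℤ; 1ℤ)
import Data.Integer.Properties as ℤ
open import Data.List.Base as List using (List; []; _∷_; _++_)
import Data.Maybe.Base as Maybe
open import Data.Nat.Base as ℕ using (ℕ; zero; suc)
open import Data.Nat.DivMod using (_mod_)
import Data.Nat.Properties as ℕ
open import Data.Product.Base using (∃; _,_; proj₁; proj₂; map₂)
open import Data.Sum.Base using ([_,_]′)
open import Data.Vec.Base as Vec using (Vec; []; _∷_)
import Data.Vec.Properties as Vec
open import Level as Level using (Level)
open import Relation.Binary.Bundles using (DecTotalOrder)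
open import Relation.Binary.PropositionalEquality as ≡ using (_≡_)
open import Relation.Nullary using (¬_; Dec; does; yes; no; contradiction)
open import Relation.Nullary.Decidable using (_×-dec_; dec⇒maybe)
open import Relation.Unary using (Pred; Decidable)

-- The constant t = 2κ/(2+κ) is the solution of (2+t)/(2-t) = 1+κ. The left side is the Padé bound
-- for e^t, which comes from the power series by comparing its tail with a geometric one. The base
-- of the power in Y stays 1+κ, as for t = ln(1+κ), so its mean is an algebraic computation; t
-- enters only through the constant factor at the threshold cT.
--
-- The obstacle is the exponential itself. It is given as a limit of partial sums in an arbitrary
-- Archimedean complete ordered field, yet the argument has to split e^(t(Y-cT)) into a random and a
-- constant factor and to merge the final exponents. Both need exp(x+y) = exp(x) exp(y), which is
-- why much of the development deals with Cauchy products. The product of two partial sums differs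
-- from the partial sum at x+y by a corner of the square of index pairs. Taking absolute values
-- there bounds the difference by a stretch of the series at |x|+|y|, which is small because that
-- series is Cauchy.

-- A ring solver with integer coefficients

module IntegerCoefficients {c ℓ} (R : CommutativeRing c ℓ) where
  open CommutativeRing R
  open import Algebra.Properties.AbelianGroup +-abelianGroup
    using (⁻¹-∙-comm)
    renaming (⁻¹-involutive to -‿involutive; ε⁻¹≈ε to -0≈0)
  open import Algebra.Properties.CommutativeSemigroup +-commutativeSemigroup
    using (interchange)
  open import Algebra.Properties.Ring ring using (-‿distribˡ-*; -‿distribʳ-*)
  open import Algebra.Properties.Semiring.Mult.TCOptimised semiring
    using (_×_; ×-homo-+; ×1-homo-*; 1+×)
  open import Algebra.Solver.Ring.AlmostCommutativeRing
    using (fromCommutativeRing; _-Raw-AlmostCommutative⟶_)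
  open import Relation.Binary.Reasoning.Setoid setoid

  -- These are the optimised multiples, for which `1 × 1#` is `1#` by computation; the solver's
  -- constants `:0` and `:1` thus denote `0#` and `1#` themselves. Integer coefficients have an
  -- equality that computes, so the normal forms cancel terms.
  fromℤ : ℤ → Carrier
  fromℤ (ℤ.+ n)  = n × 1#
  fromℤ -[1+ n ] = - (suc n × 1#)

  fromℤ-⊖ : ∀ m n → fromℤ (m ℤ.⊖ n) ≈ m × 1# - n × 1#
  fromℤ-⊖ m       zero    = sym (trans (+-congˡ -0≈0) (+-identityʳ _))
  fromℤ-⊖ zero    (suc n) = sym (+-identityˡ _)
  fromℤ-⊖ (suc m) (suc n) = begin
    fromℤ (suc m ℤ.⊖ suc n)          ≡⟨ ≡.cong fromℤ (ℤ.[1+m]⊖[1+n]≡m⊖n m n) ⟩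
    fromℤ (m ℤ.⊖ n)                  ≈⟨ fromℤ-⊖ m n ⟩
    m × 1# - n × 1#                  ≈⟨ +-identityˡ _ ⟨
    0# + (m × 1# - n × 1#)           ≈⟨ +-congʳ (-‿inverseʳ 1#) ⟨
    (1# - 1#) + (m × 1# - n × 1#)    ≈⟨ interchange 1# (- 1#) (m × 1#) (- (n × 1#)) ⟩
    (1# + m × 1#) + (- 1# - n × 1#)  ≈⟨ +-congˡ (⁻¹-∙-comm 1# (n × 1#)) ⟩
    (1# + m × 1#) - (1# + n × 1#)    ≈⟨ +-cong (1+× m 1#) (-‿cong (1+× n 1#)) ⟨
    suc m × 1# - suc n × 1#          ∎

  fromℤ-homo-neg : ∀ i → fromℤ (ℤ.- i) ≈ - fromℤ i
  fromℤ-homo-neg (ℤ.+ zero)  = sym -0≈0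
  fromℤ-homo-neg (ℤ.+ suc n) = refl
  fromℤ-homo-neg -[1+ n ]    = sym (-‿involutive _)

  fromℤ-homo-+ : ∀ i j → fromℤ (i ℤ.+ j) ≈ fromℤ i + fromℤ j
  fromℤ-homo-+ (ℤ.+ m)  (ℤ.+ n)  = ×-homo-+ 1# m n
  fromℤ-homo-+ (ℤ.+ m)  -[1+ n ] = fromℤ-⊖ m (suc n)
  fromℤ-homo-+ -[1+ m ] (ℤ.+ n)  = trans (fromℤ-⊖ n (suc m)) (+-comm _ _)
  fromℤ-homo-+ -[1+ m ] -[1+ n ] = begin
    fromℤ (-[1+ m ] ℤ.+ -[1+ n ])            ≡⟨ ≡.cong fromℤ (ℤ.neg-distrib-+ (ℤ.+ suc m) (ℤ.+ suc n)) ⟨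
    - ((suc m ℕ.+ suc n) × 1#)               ≈⟨ -‿cong (×-homo-+ 1# (suc m) (suc n)) ⟩
    - (suc m × 1# + suc n × 1#)              ≈⟨ ⁻¹-∙-comm _ _ ⟨
    - (suc m × 1#) - suc n × 1#              ∎

  fromℤ-homo-+* : ∀ m j → fromℤ (ℤ.+ m ℤ.* j) ≈ m × 1# * fromℤ j
  fromℤ-homo-+* m (ℤ.+ n)  = trans (reflexive (≡.cong fromℤ (≡.sym (ℤ.pos-* m n)))) (×1-homo-* m n)
  fromℤ-homo-+* m -[1+ n ] = begin
    fromℤ (ℤ.+ m ℤ.* -[1+ n ])         ≡⟨ ≡.cong fromℤ (ℤ.neg-distribʳ-* (ℤ.+ m) (ℤ.+ suc n)) ⟨
    fromℤ (ℤ.- (ℤ.+ m ℤ.* ℤ.+ suc n))  ≈⟨ fromℤ-homo-neg (ℤ.+ m ℤ.* ℤ.+ suc n) ⟩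
    - fromℤ (ℤ.+ m ℤ.* ℤ.+ suc n)      ≈⟨ -‿cong (fromℤ-homo-+* m (ℤ.+ suc n)) ⟩
    - (m × 1# * (suc n × 1#))          ≈⟨ -‿distribʳ-* _ _ ⟩
    m × 1# * - (suc n × 1#)            ∎

  fromℤ-homo-* : ∀ i j → fromℤ (i ℤ.* j) ≈ fromℤ i * fromℤ j
  fromℤ-homo-* (ℤ.+ m)  j = fromℤ-homo-+* m j
  fromℤ-homo-* -[1+ m ] j = begin
    fromℤ (-[1+ m ] ℤ.* j)         ≡⟨ ≡.cong fromℤ (ℤ.neg-distribˡ-* (ℤ.+ suc m) j) ⟨
    fromℤ (ℤ.- (ℤ.+ suc m ℤ.* j))  ≈⟨ fromℤ-homo-neg (ℤ.+ suc m ℤ.* j) ⟩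
    - fromℤ (ℤ.+ suc m ℤ.* j)      ≈⟨ -‿cong (fromℤ-homo-+* (suc m) j) ⟩
    - (suc m × 1# * fromℤ j)       ≈⟨ -‿distribˡ-* _ _ ⟩
    - (suc m × 1#) * fromℤ j       ∎

  fromℤ-morphism : ℤ.+-*-rawRing -Raw-AlmostCommutative⟶ fromCommutativeRing R
  fromℤ-morphism = record
    { ⟦_⟧    = fromℤ
    ; +-homo = fromℤ-homo-+
    ; *-homo = fromℤ-homo-*
    ; -‿homo = fromℤ-homo-neg
    ; 0-homo = refl
    ; 1-homo = refl
    }

  open import Algebra.Solver.Ring ℤ.+-*-rawRing (fromCommutativeRing R) fromℤ-morphism
    (λ i j → Maybe.map (λ i≡j → reflexive (≡.cong fromℤ i≡j)) (dec⇒maybe (i ℤ.≟ j))) public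
    using (Polynomial; solve; _:=_; con; _:+_; _:*_; _:-_; :-_)

  :0 :1 : ∀ {n} → Polynomial n
  :0 = con 0ℤ
  :1 = con 1ℤ

-- Inequalities in an ordered field

module RealProperties {c ℓ₁ ℓ₂} (ℝ : RealField c ℓ₁ ℓ₂) where
  open HashCounting ℝ hiding (Y; exp)
  open Exponential ℝ using (expSeries-cauchy)
  open OrderedFieldProperties orderedField public
  open IntegerCoefficients commutativeRing public
  open import Algebra.Construct.NaturalChoice.Max totalOrder
    using (⊔-lub)
  open import Algebra.Properties.Semiring.Exp semiring using (^-congˡ)
  open import Relation.Binary.Reasoning.PartialOrder
    (DecTotalOrder.poset decTotalOrder)

  +-nonNeg : ∀ {x y} → 0# ≤ x → 0# ≤ y → 0# ≤ x + y
  +-nonNeg 0≤x 0≤y = ≤-respˡ (+-identityˡ 0#) (+-mono-≤ 0≤x 0≤y)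

  *-mono-≤ : ∀ {x y u v} → 0# ≤ y → 0# ≤ u → x ≤ y → u ≤ v → x * u ≤ y * v
  *-mono-≤ 0≤y 0≤u x≤y u≤v = ≤-trans (*-monoˡ-≤ 0≤u x≤y) (*-monoʳ-≤ 0≤y u≤v)

  x≤x+y : ∀ {x y} → 0# ≤ y → x ≤ x + y
  x≤x+y {x} 0≤y = ≤-respˡ (+-identityʳ x) (+-monoʳ-≤ x 0≤y)

  x-y≤0⇒x≤y : ∀ {x y} → x - y ≤ 0# → x ≤ y
  x-y≤0⇒x≤y {x} {y} x-y≤0 = begin
    x            ≈⟨ solve 2 (λ x y → x := (x :- y) :+ y) refl x y ⟩
    (x - y) + y  ≤⟨ +-monoˡ-≤ y x-y≤0 ⟩
    0# + y       ≈⟨ +-identityˡ y ⟩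
    y            ∎

  0<⇒≉0 : ∀ {x} → 0# < x → ¬ x ≈ 0#
  0<⇒≉0 (_ , 0≉x) x≈0 = 0≉x (sym x≈0)

  ≉0∧0≤⇒0< : ∀ {x} → 0# ≤ x → ¬ x ≈ 0# → 0# < x
  ≉0∧0≤⇒0< 0≤x x≉0 = 0≤x , λ 0≈x → x≉0 (sym 0≈x)

  1≤⇒0< : ∀ {x} → 1# ≤ x → 0# < x
  1≤⇒0< 1≤x = ≉0∧0≤⇒0< (≤-trans 0≤1 1≤x) (1≤x⇒x≉0 1≤x)

  *-inverseˡ : ∀ {x} → ¬ x ≈ 0# → x ⁻¹ * x ≈ 1#
  *-inverseˡ x≉0 = trans (*-comm _ _) (*-inverseʳ x≉0)

  *-cancelʳ : ∀ {x y z} → ¬ z ≈ 0# → x * z ≈ y * z → x ≈ y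
  *-cancelʳ {x} {y} {z} z≉0 xz≈yz = begin-equality
    x               ≈⟨ *-identityʳ x ⟨
    x * 1#          ≈⟨ *-congˡ (*-inverseʳ z≉0) ⟨
    x * (z * z ⁻¹)  ≈⟨ *-assoc x z _ ⟨
    x * z * z ⁻¹    ≈⟨ *-congʳ xz≈yz ⟩
    y * z * z ⁻¹    ≈⟨ *-assoc y z _ ⟩
    y * (z * z ⁻¹)  ≈⟨ *-congˡ (*-inverseʳ z≉0) ⟩
    y * 1#          ≈⟨ *-identityʳ y ⟩
    y               ∎

  /-*-cancel : ∀ x {y} → ¬ y ≈ 0# → x / y * y ≈ x
  /-*-cancel x {y} y≉0 = begin-equality
    x * y ⁻¹ * y    ≈⟨ *-assoc x _ y ⟩
    x * (y ⁻¹ * y)  ≈⟨ *-congˡ (*-inverseˡ y≉0) ⟩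
    x * 1#          ≈⟨ *-identityʳ x ⟩
    x               ∎

  0<* : ∀ {x y} → 0# < x → 0# < y → 0# < x * y
  0<* 0<x 0<y = ≉0∧0≤⇒0< (*-nonNeg (proj₁ 0<x) (proj₁ 0<y))
    λ xy≈0 → 0<⇒≉0 0<x (*-cancelʳ (0<⇒≉0 0<y) (trans xy≈0 (sym (zeroˡ _))))

  0<⁻¹ : ∀ {x} → 0# < x → 0# < x ⁻¹
  0<⁻¹ {x} 0<x = ≉0∧0≤⇒0< (0≤x⁻¹ (0<⇒≉0 0<x) (proj₁ 0<x))
    λ x⁻¹≈0 → 1≉0 (trans (sym (*-inverseʳ (0<⇒≉0 0<x))) (trans (*-congˡ x⁻¹≈0) (zeroʳ x)))

  0<2 : 0# < 2#
  0<2 = 1≤⇒0< (x≤x+y 0≤1)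

  0<½ : 0# < ½
  0<½ = 0<* (1≤⇒0< ≤-refl) (0<⁻¹ 0<2)

  ½+½≈1 : ½ + ½ ≈ 1#
  ½+½≈1 = begin-equality
    ½ + ½   ≈⟨ solve 1 (λ h → h :+ h := h :* (:1 :+ :1)) refl ½ ⟩
    ½ * 2#  ≈⟨ /-*-cancel 1# (0<⇒≉0 0<2) ⟩
    1#      ∎

  x½+x½≈x : ∀ x → x * ½ + x * ½ ≈ x
  x½+x½≈x x = trans (sym (distribˡ x ½ ½)) (trans (*-congˡ ½+½≈1) (*-identityʳ x))

  -- For positive x the choice ε = x/2 is admissible, and replacing x by x/2 twice in x + x/2 - x/2
  -- already yields x ≤ 0.
  ≤-all-pos⇒≤0 : ∀ {x} → (∀ ε → 0# < ε → x ≤ ε) → x ≤ 0#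
  ≤-all-pos⇒≤0 {x} x≤ε with x ≤? 0#
  ... | yes x≤0 = x≤0
  ... | no  x≰0 = contradiction x≤0 x≰0
    where
    0<x½ : 0# < x * ½
    0<x½ = 0<* (≰⇒> x≰0) 0<½
    x≤0 : x ≤ 0#
    x≤0 = begin
      x                              ≈⟨ x½+x½≈x x ⟨
      x * ½ + x * ½                  ≈⟨ solve 1 (λ h → h :+ h := h :+ h :+ h :- h) refl (x * ½) ⟩
      x * ½ + x * ½ + x * ½ - x * ½  ≈⟨ +-congʳ (+-congʳ (x½+x½≈x x)) ⟩
      x + x * ½ - x * ½              ≤⟨ +-monoˡ-≤ (- (x * ½)) (+-monoˡ-≤ (x * ½) (x≤ε _ 0<x½)) ⟩
      x * ½ + x * ½ - x * ½          ≈⟨ +-congʳ (x½+x½≈x x) ⟩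
      x - x * ½                      ≤⟨ +-monoˡ-≤ (- (x * ½)) (x≤ε _ 0<x½) ⟩
      x * ½ - x * ½                  ≈⟨ -‿inverseʳ _ ⟩
      0#                             ∎

  ∣∣-lub : ∀ {x a} → x ≤ a → - x ≤ a → ∣ x ∣ ≤ a
  ∣∣-lub = ⊔-lub

  ∣x+y∣≤∣x∣+∣y∣ : ∀ x y → ∣ x + y ∣ ≤ ∣ x ∣ + ∣ y ∣
  ∣x+y∣≤∣x∣+∣y∣ x y = ∣∣-lub (+-mono-≤ (x≤∣x∣ x) (x≤∣x∣ y))
    (≤-respˡ (solve 2 (λ x y → :- x :+ :- y := :- (x :+ y)) refl x y)
      (+-mono-≤ (-x≤∣x∣ x) (-x≤∣x∣ y)))

  ∣x*y∣≤∣x∣*∣y∣ : ∀ x y → ∣ x * y ∣ ≤ ∣ x ∣ * ∣ y ∣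
  ∣x*y∣≤∣x∣*∣y∣ x y = ∣∣-lub
    (*-bound (x≤∣x∣ x) (-x≤∣x∣ x) (x≤∣x∣ y) (-x≤∣x∣ y) (0≤∣x∣ y))
    (≤-respˡ (solve 2 (λ x y → (:- x) :* y := :- (x :* y)) refl x y)
      (*-bound (-x≤∣x∣ x) (≤-respˡ (solve 1 (λ x → x := :- (:- x)) refl x) (x≤∣x∣ x))
        (x≤∣x∣ y) (-x≤∣x∣ y) (0≤∣x∣ y)))

  x-y≤∣y-x∣ : ∀ x y → x - y ≤ ∣ y - x ∣
  x-y≤∣y-x∣ x y = ≤-respˡ (solve 2 (λ x y → :- (y :- x) := x :- y) refl x y) (-x≤∣x∣ (y - x))

  -- Null sequences and limits

  -- Unlike in `_⟶_` the bound is not strict, so that estimates can be chained by `≤` alone.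
  Null : (ℕ → Carrier) → Set _
  Null u = ∀ ε → 0# < ε → ∃ λ N → ∀ n → N ℕ.≤ n → ∣ u n ∣ ≤ ε

  ⟶⇒null : ∀ {s l} → s ⟶ l → Null (λ n → s n - l)
  ⟶⇒null {s} {l} s⟶l ε 0<ε = let N , bound = s⟶l ε 0<ε in N , λ n N≤n → proj₁ (bound n N≤n)

  null-+ : ∀ {u v} → Null u → Null v → Null (λ n → u n + v n)
  null-+ {u} {v} u→0 v→0 ε 0<ε =
    let ε½ = 0<* 0<ε 0<½
        M , u≤ = u→0 _ ε½
        N , v≤ = v→0 _ ε½
    in M ℕ.+ N , λ n M+N≤n → begin
      ∣ u n + v n ∣      ≤⟨ ∣x+y∣≤∣x∣+∣y∣ (u n) (v n) ⟩
      ∣ u n ∣ + ∣ v n ∣  ≤⟨ +-mono-≤ (u≤ n (ℕ.m+n≤o⇒m≤o M M+N≤n)) (v≤ n (ℕ.m+n≤o⇒n≤o M M+N≤n)) ⟩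
      ε * ½ + ε * ½      ≈⟨ x½+x½≈x ε ⟩
      ε                  ∎

  null-bounded-* : ∀ {u v : ℕ → Carrier} b → (∃ λ N → ∀ n → N ℕ.≤ n → ∣ u n ∣ ≤ b) →
                   Null v → Null (λ n → u n * v n)
  null-bounded-* {u} {v} b (M , u≤b) v→0 ε 0<ε =
    let N , v≤ = v→0 (ε / b′) (0<* 0<ε (0<⁻¹ 0<b′))
    in M ℕ.+ N , λ n M+N≤n → begin
      ∣ u n * v n ∣      ≤⟨ ∣x*y∣≤∣x∣*∣y∣ (u n) (v n) ⟩
      ∣ u n ∣ * ∣ v n ∣  ≤⟨ *-mono-≤ (proj₁ 0<b′) (0≤∣x∣ (v n))
                              (≤-trans (u≤b n (ℕ.m+n≤o⇒m≤o M M+N≤n)) b≤b′)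
                              (v≤ n (ℕ.m+n≤o⇒n≤o M M+N≤n)) ⟩
      b′ * (ε / b′)      ≈⟨ *-comm b′ _ ⟩
      ε / b′ * b′        ≈⟨ /-*-cancel ε (0<⇒≉0 0<b′) ⟩
      ε                  ∎
    where
    -- The summand 1 makes the bound invertible, even for b = 0.
    b′ : Carrier
    b′ = 1# + ∣ b ∣
    0<b′ : 0# < b′
    0<b′ = 1≤⇒0< (x≤x+y (0≤∣x∣ b))
    b≤b′ : b ≤ b′
    b≤b′ = ≤-trans (x≤∣x∣ b) (≤-respˡ (+-identityˡ _) (+-monoˡ-≤ _ 0≤1))

  null-≤⇒≤0 : ∀ {u : ℕ → Carrier} {a} N → Null u → (∀ n → N ℕ.≤ n → a ≤ ∣ u n ∣) → a ≤ 0#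
  null-≤⇒≤0 N u→0 a≤u = ≤-all-pos⇒≤0 λ ε 0<ε →
    let M , u≤ = u→0 ε 0<ε
    in ≤-trans (a≤u (M ℕ.+ N) (ℕ.m≤n+m N M)) (u≤ (M ℕ.+ N) (ℕ.m≤m+n M N))

  ⟶-bounded : ∀ {s : ℕ → Carrier} {l} → s ⟶ l → ∃ λ N → ∀ n → N ℕ.≤ n → ∣ s n ∣ ≤ ∣ l ∣ + 1#
  ⟶-bounded {s} {l} s⟶l =
    let N , bound = ⟶⇒null {s} {l} s⟶l 1# (1≤⇒0< ≤-refl)
    in N , λ n N≤n → ∣∣-lub
      (begin
        s n            ≈⟨ solve 2 (λ s l → s := l :+ (s :- l)) refl (s n) l ⟩
        l + (s n - l)  ≤⟨ +-mono-≤ (x≤∣x∣ l) (≤-trans (x≤∣x∣ _) (bound n N≤n)) ⟩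
        ∣ l ∣ + 1#     ∎)
      (begin
        - s n              ≈⟨ solve 2 (λ s l → :- s := :- l :+ :- (s :- l)) refl (s n) l ⟩
        - l + - (s n - l)  ≤⟨ +-mono-≤ (-x≤∣x∣ l) (≤-trans (-x≤∣x∣ _) (bound n N≤n)) ⟩
        ∣ l ∣ + 1#         ∎)

  limit-mono-≤ : ∀ {s s′ : ℕ → Carrier} {l l′} N → s ⟶ l → s′ ⟶ l′ →
                 (∀ n → N ℕ.≤ n → s n ≤ s′ n) → l ≤ l′
  limit-mono-≤ {s} {s′} {l} {l′} N s⟶l s′⟶l′ s≤s′ =
    x-y≤0⇒x≤y (≤-all-pos⇒≤0 λ ε 0<ε →
      let L , s≤  = ⟶⇒null {s} {l} s⟶l   _ (0<* 0<ε 0<½)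
          M , s′≤ = ⟶⇒null {s′} {l′} s′⟶l′ _ (0<* 0<ε 0<½)
          n       = L ℕ.+ M ℕ.+ N
          L+M≤n   = ℕ.m≤m+n (L ℕ.+ M) N
      in begin
        l - l′                        ≈⟨ solve 4 (λ s s′ l l′ → l :- l′ := (l :- s) :+ (s :- s′) :+ (s′ :- l′)) refl (s n) (s′ n) l l′ ⟩
        (l - s n) + (s n - s′ n) + (s′ n - l′)
          ≤⟨ +-mono-≤ (+-mono-≤ (≤-trans (x-y≤∣y-x∣ l (s n)) (s≤ n (ℕ.m+n≤o⇒m≤o L L+M≤n)))
               (≤-respʳ (-‿inverseʳ (s′ n)) (+-monoˡ-≤ (- s′ n) (s≤s′ n (ℕ.m≤n+m N (L ℕ.+ M))))))
               (≤-trans (x≤∣x∣ _) (s′≤ n (ℕ.m+n≤o⇒n≤o L L+M≤n))) ⟩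
        ε * ½ + 0# + ε * ½            ≈⟨ +-congʳ (+-identityʳ _) ⟩
        ε * ½ + ε * ½                 ≈⟨ x½+x½≈x ε ⟩
        ε                             ∎)

  const-⟶ : ∀ x → (λ _ → x) ⟶ x
  const-⟶ x ε (0≤ε , 0≉ε) = 0 , λ n _ →
    ∣∣-lub (≤-respˡ (sym (-‿inverseʳ x)) 0≤ε)
           (≤-respˡ (solve 1 (λ x → :0 := :- (x :- x)) refl x) 0≤ε) ,
    λ ∣x-x∣≈ε → 0≉ε (≤-antisym 0≤ε (≤-respˡ ∣x-x∣≈ε
      (∣∣-lub (≤-reflexive (-‿inverseʳ x)) (≤-reflexive (solve 1 (λ x → :- (x :- x) := :0) refl x)))))

  -- Cauchy products and regions of index pairs

  Seq : Set _
  Seq = ℕ → Carrier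

  shift : Seq → Seq
  shift a i = a (suc i)

  -- The recursion splits off i = 0 and shifts `a`, so the complementary index n - i never requires
  -- a subtraction in ℕ.
  cauchyProduct : Seq → Seq → Seq
  cauchyProduct a b zero    = a 0 * b 0
  cauchyProduct a b (suc n) = a 0 * b (suc n) + cauchyProduct (shift a) b n

  -- The sum of aᵢ bⱼ over i + j < N.
  triangle : Seq → Seq → Seq
  triangle a b zero    = 0#
  triangle a b (suc N) = a 0 * partialSum b (suc N) + triangle (shift a) b N

  -- The sum of aᵢ bⱼ over i < N, j < M and N ≤ i + j.
  corner : Seq → Seq → ℕ → Seq
  corner a b M zero    = 0#
  corner a b M (suc N) = a 0 * (partialSum b M - partialSum b (suc N)) + corner (shift a) b M N

  partialSum-shift : ∀ a N → partialSum a (suc N) ≈ a 0 + partialSum (shift a) N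
  partialSum-shift a zero    = +-comm _ _
  partialSum-shift a (suc N) = trans (+-congʳ (partialSum-shift a N)) (+-assoc _ _ _)

  partialSum-cong : ∀ {a b : Seq} → (∀ i → a i ≈ b i) → ∀ N → partialSum a N ≈ partialSum b N
  partialSum-cong a≈b zero    = refl
  partialSum-cong a≈b (suc N) = +-cong (partialSum-cong a≈b N) (a≈b N)

  0≤partialSum : ∀ {a : Seq} → (∀ i → 0# ≤ a i) → ∀ N → 0# ≤ partialSum a N
  0≤partialSum 0≤a zero    = ≤-refl
  0≤partialSum 0≤a (suc N) = +-nonNeg (0≤partialSum 0≤a N) (0≤a N)

  partialSum-mono : ∀ {a : Seq} → (∀ i → 0# ≤ a i) → ∀ {m n} → m ℕ.≤′ n → partialSum a m ≤ partialSum a n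
  partialSum-mono 0≤a ℕ.≤′-refl       = ≤-refl
  partialSum-mono 0≤a (ℕ.≤′-step m≤n) = ≤-trans (partialSum-mono 0≤a m≤n) (x≤x+y (0≤a _))

  -- The larger triangle gains exactly the antidiagonal i + j = N.
  triangle-suc : ∀ a b N → triangle a b (suc N) ≈ triangle a b N + cauchyProduct a b N
  triangle-suc a b zero    = solve 2 (λ a b → a :* (:0 :+ b) :+ :0 := :0 :+ a :* b) refl (a 0) (b 0)
  triangle-suc a b (suc N) = begin-equality
    a 0 * (B + b (suc N)) + triangle (shift a) b (suc N)
      ≈⟨ +-congˡ (triangle-suc (shift a) b N) ⟩
    a 0 * (B + b (suc N)) + (triangle (shift a) b N + cauchyProduct (shift a) b N)
      ≈⟨ solve 5 (λ a B b t c → a :* (B :+ b) :+ (t :+ c) := (a :* B :+ t) :+ (a :* b :+ c)) refl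
           (a 0) B (b (suc N)) _ _ ⟩
    triangle a b (suc N) + cauchyProduct a b (suc N)  ∎
    where
    B : Carrier
    B = partialSum b (suc N)

  partialSum-cauchyProduct : ∀ a b N → partialSum (cauchyProduct a b) N ≈ triangle a b N
  partialSum-cauchyProduct a b zero    = refl
  partialSum-cauchyProduct a b (suc N) =
    trans (+-congʳ (partialSum-cauchyProduct a b N)) (sym (triangle-suc a b N))

  -- This writes the error of multiplying partial sums as a sum over a region, where absolute values
  -- can be taken term by term.
  corner≈ : ∀ a b M N → corner a b M N ≈ partialSum a N * partialSum b M - triangle a b N
  corner≈ a b M zero    = solve 1 (λ B → :0 := :0 :* B :- :0) refl (partialSum b M)
  corner≈ a b M (suc N) = begin-equality
    a 0 * (B - B′) + corner (shift a) b M N       ≈⟨ +-congˡ (corner≈ (shift a) b M N) ⟩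
    a 0 * (B - B′) + (A * B - triangle (shift a) b N)
      ≈⟨ solve 5 (λ a B B′ A t → a :* (B :- B′) :+ (A :* B :- t) := (a :+ A) :* B :- (a :* B′ :+ t)) refl
           (a 0) B B′ A _ ⟩
    (a 0 + A) * B - triangle a b (suc N)          ≈⟨ +-congʳ (*-congʳ (partialSum-shift a N)) ⟨
    partialSum a (suc N) * B - triangle a b (suc N)  ∎
    where
    A B B′ : Carrier
    A  = partialSum (shift a) N
    B  = partialSum b M
    B′ = partialSum b (suc N)

  -- The rectangle lies inside the triangle, since i < N and j < M give i + j < N + M; the terms
  -- outside it are nonnegative.
  product≤triangle : ∀ {a b : Seq} → (∀ i → 0# ≤ a i) → (∀ i → 0# ≤ b i) →
                     ∀ N M → partialSum a N * partialSum b M ≤ triangle a b (N ℕ.+ M)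
  product≤triangle {a} {b} 0≤a 0≤b zero M = begin
    0# * partialSum b M  ≈⟨ zeroˡ _ ⟩
    0#                   ≤⟨ 0≤partialSum (0≤cauchyProduct 0≤a) M ⟩
    partialSum (cauchyProduct a b) M  ≈⟨ partialSum-cauchyProduct a b M ⟩
    triangle a b M       ∎
    where
    0≤cauchyProduct : ∀ {a} → (∀ i → 0# ≤ a i) → ∀ n → 0# ≤ cauchyProduct a b n
    0≤cauchyProduct 0≤a zero    = *-nonNeg (0≤a 0) (0≤b 0)
    0≤cauchyProduct 0≤a (suc n) =
      +-nonNeg (*-nonNeg (0≤a 0) (0≤b (suc n))) (0≤cauchyProduct (λ i → 0≤a (suc i)) n)
  product≤triangle {a} {b} 0≤a 0≤b (suc N) M = begin
    partialSum a (suc N) * B             ≈⟨ *-congʳ (partialSum-shift a N) ⟩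
    (a 0 + partialSum (shift a) N) * B   ≈⟨ distribʳ B _ _ ⟩
    a 0 * B + partialSum (shift a) N * B
      ≤⟨ +-mono-≤ (*-monoʳ-≤ (0≤a 0) (partialSum-mono 0≤b (ℕ.≤⇒≤′ (ℕ.m≤n⇒m≤1+n (ℕ.m≤n+m M N)))))
                  (product≤triangle (λ i → 0≤a (suc i)) 0≤b N M) ⟩
    triangle a b (suc N ℕ.+ M)           ∎
    where
    B : Carrier
    B = partialSum b M

  module _ {b B : Seq} (∣b∣≤B : ∀ i → ∣ b i ∣ ≤ B i) where

    ∣partialSum-diff∣ : ∀ {m n} → m ℕ.≤′ n →
      ∣ partialSum b n - partialSum b m ∣ ≤ partialSum B n - partialSum B m
    ∣partialSum-diff∣ {m} ℕ.≤′-refl = ∣∣-lub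
      (≤-reflexive (solve 2 (λ x y → x :- x := y :- y) refl _ _))
      (≤-reflexive (solve 2 (λ x y → :- (x :- x) := y :- y) refl _ _))
    ∣partialSum-diff∣ {m} {suc n} (ℕ.≤′-step m≤n) = begin
      ∣ (s + b n) - sₘ ∣        ≤⟨ ∣∣-lub (≤-respˡ split (x≤∣x∣ _)) (≤-respˡ (-‿cong split) (-x≤∣x∣ _)) ⟩
      ∣ (s - sₘ) + b n ∣        ≤⟨ ∣x+y∣≤∣x∣+∣y∣ _ _ ⟩
      ∣ s - sₘ ∣ + ∣ b n ∣      ≤⟨ +-mono-≤ (∣partialSum-diff∣ m≤n) (∣b∣≤B n) ⟩
      (partialSum B n - partialSum B m) + B n
        ≈⟨ solve 3 (λ s t u → (s :- t) :+ u := (s :+ u) :- t) refl _ _ _ ⟩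
      (partialSum B n + B n) - partialSum B m  ∎
      where
      s sₘ : Carrier
      s  = partialSum b n
      sₘ = partialSum b m
      split : (s - sₘ) + b n ≈ (s + b n) - sₘ
      split = solve 3 (λ s t u → (s :- t) :+ u := (s :+ u) :- t) refl _ _ _

    -- The condition `N ≤ M` makes every row difference run forward, over a genuine stretch of
    -- terms, so that the triangle inequality bounds it by the same stretch of `B`.
    ∣corner∣ : ∀ {a A : Seq} → (∀ i → ∣ a i ∣ ≤ A i) → ∀ {M} N → N ℕ.≤ M →
               ∣ corner a b M N ∣ ≤ corner A B M N
    ∣corner∣ ∣a∣≤A zero N≤M = ∣∣-lub ≤-refl (≤-reflexive (solve 0 (:- :0 := :0) refl))
    ∣corner∣ {a} {A} ∣a∣≤A {M} (suc N) N<M = begin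
      ∣ a 0 * d + corner (shift a) b M N ∣        ≤⟨ ∣x+y∣≤∣x∣+∣y∣ _ _ ⟩
      ∣ a 0 * d ∣ + ∣ corner (shift a) b M N ∣    ≤⟨ +-mono-≤
        (≤-trans (∣x*y∣≤∣x∣*∣y∣ (a 0) d)
          (*-mono-≤ (≤-trans (0≤∣x∣ (a 0)) (∣a∣≤A 0)) (0≤∣x∣ d) (∣a∣≤A 0) (∣partialSum-diff∣ (ℕ.≤⇒≤′ N<M))))
        (∣corner∣ (λ i → ∣a∣≤A (suc i)) N (ℕ.<⇒≤ N<M)) ⟩
      corner A B M (suc N)                        ∎
      where
      d : Carrier
      d = partialSum b M - partialSum b (suc N)

  cauchyProduct-congˡ : ∀ {a a′ : Seq} b → (∀ i → a i ≈ a′ i) → ∀ n → cauchyProduct a b n ≈ cauchyProduct a′ b n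
  cauchyProduct-congˡ b a≈a′ zero    = *-congʳ (a≈a′ 0)
  cauchyProduct-congˡ b a≈a′ (suc n) =
    +-cong (*-congʳ (a≈a′ 0)) (cauchyProduct-congˡ b (λ i → a≈a′ (suc i)) n)

  cauchyProduct-congʳ : ∀ a {b b′ : Seq} → (∀ i → b i ≈ b′ i) → ∀ n → cauchyProduct a b n ≈ cauchyProduct a b′ n
  cauchyProduct-congʳ a b≈b′ zero    = *-congˡ (b≈b′ 0)
  cauchyProduct-congʳ a b≈b′ (suc n) =
    +-cong (*-congˡ (b≈b′ (suc n))) (cauchyProduct-congʳ (shift a) b≈b′ n)

  cauchyProduct-scaleˡ : ∀ x a b n → cauchyProduct (λ i → x * a i) b n ≈ x * cauchyProduct a b n
  cauchyProduct-scaleˡ x a b zero    = *-assoc _ _ _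
  cauchyProduct-scaleˡ x a b (suc n) =
    trans (+-cong (*-assoc _ _ _) (cauchyProduct-scaleˡ x (shift a) b n)) (sym (distribˡ x _ _))

  cauchyProduct-scaleʳ : ∀ x a b n → cauchyProduct a (λ i → x * b i) n ≈ x * cauchyProduct a b n
  cauchyProduct-scaleʳ x a b zero    = solve 3 (λ x a b → a :* (x :* b) := x :* (a :* b)) refl x _ _
  cauchyProduct-scaleʳ x a b (suc n) = trans
    (+-congˡ (cauchyProduct-scaleʳ x (shift a) b n))
    (solve 4 (λ x a b c → a :* (x :* b) :+ x :* c := x :* (a :* b :+ c)) refl x _ _ _)

  -- In `expTerm-+` the second factor has the terms j·b(j); the one at j = 0 vanishes, so the
  -- splitting has to happen at this end.
  cauchyProduct-sucʳ : ∀ a b n → cauchyProduct a b (suc n) ≈ cauchyProduct a (shift b) n + a (suc n) * b 0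
  cauchyProduct-sucʳ a b zero    = refl
  cauchyProduct-sucʳ a b (suc n) =
    trans (+-congˡ (cauchyProduct-sucʳ (shift a) b n)) (sym (+-assoc _ _ _))

  -- The Leibniz rule for x d/dx on power series; the offset w makes the
  -- induction over shifts of a go through.
  cauchyProduct-leibniz : ∀ w a b n →
    cauchyProduct (λ i → (w + fromℕ i) * a i) b n + cauchyProduct a (λ j → fromℕ j * b j) n
      ≈ (w + fromℕ n) * cauchyProduct a b n
  cauchyProduct-leibniz w a b zero    =
    solve 3 (λ w a b → ((w :+ :0) :* a) :* b :+ a :* (:0 :* b) := (w :+ :0) :* (a :* b)) refl w _ _
  cauchyProduct-leibniz w a b (suc n) = begin-equality
    (w + 0#) * a 0 * b₁ + cauchyProduct (λ i → (w + fromℕ (suc i)) * a (suc i)) b n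
      + (a 0 * (n₁ * b₁) + q)
      ≈⟨ +-congʳ (+-congˡ (cauchyProduct-congˡ b (λ i → *-congʳ (sym (+-assoc w 1# (fromℕ i)))) n)) ⟩
    (w + 0#) * a 0 * b₁ + p + (a 0 * (n₁ * b₁) + q)
      ≈⟨ solve 6 (λ w a b n p q →
           (w :+ :0) :* a :* b :+ p :+ (a :* ((:1 :+ n) :* b) :+ q)
             := (w :+ (:1 :+ n)) :* (a :* b) :+ (p :+ q)) refl w (a 0) b₁ (fromℕ n) p q ⟩
    (w + n₁) * (a 0 * b₁) + (p + q)
      ≈⟨ +-congˡ (cauchyProduct-leibniz (w + 1#) (shift a) b n) ⟩
    (w + n₁) * (a 0 * b₁) + (w + 1# + fromℕ n) * r
      ≈⟨ solve 5 (λ w n a b r → (w :+ (:1 :+ n)) :* (a :* b) :+ (w :+ :1 :+ n) :* r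
           := (w :+ (:1 :+ n)) :* (a :* b :+ r)) refl w (fromℕ n) (a 0) b₁ r ⟩
    (w + n₁) * (a 0 * b₁ + r)  ∎
    where
    n₁ b₁ p q r : Carrier
    n₁ = fromℕ (suc n)
    b₁ = b (suc n)
    p  = cauchyProduct (λ i → (w + 1# + fromℕ i) * a (suc i)) b n
    q  = cauchyProduct (shift a) (λ j → fromℕ j * b j) n
    r  = cauchyProduct (shift a) b n

  -- Terms of the exponential series

  expTerm-0 : ∀ x → expTerm x 0 ≈ 1#
  expTerm-0 x = *-cancelʳ (1≤x⇒x≉0 (1≤fromℕ 0)) (begin-equality
    expTerm x 0 * fromℕ 1  ≈⟨ /-*-cancel 1# (1≤x⇒x≉0 (1≤fromℕ 0)) ⟩
    1#                     ≈⟨ solve 0 (:1 := :1 :* (:1 :+ :0)) refl ⟩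
    1# * fromℕ 1           ∎)

  -- Coefficientwise, this is the differential equation E′ = xE of the series E(z) = exp(xz).
  fromℕ-*-expTerm : ∀ x k → fromℕ (suc k) * expTerm x (suc k) ≈ x * expTerm x k
  fromℕ-*-expTerm x k = begin-equality
    n * expTerm x (suc k)      ≈⟨ *-congˡ (expTerm-suc x k) ⟩
    n * (expTerm x k * (x / n)) ≈⟨ solve 3 (λ n e q → n :* (e :* q) := (q :* n) :* e) refl n _ _ ⟩
    x / n * n * expTerm x k    ≈⟨ *-congʳ (/-*-cancel x (fromℕ-suc≉0 k)) ⟩
    x * expTerm x k            ∎
    where
    n : Carrier
    n = fromℕ (suc k)

  -- The binomial theorem without binomial coefficients: by the Leibniz rule and `fromℕ-*-expTerm`,
  -- the Cauchy product satisfies c(0) = 1 and (n+1) c(n+1) = (x+y) c(n), the recursion that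
  -- determines the terms at x + y.
  expTerm-+ : ∀ x y n → cauchyProduct (expTerm x) (expTerm y) n ≈ expTerm (x + y) n
  expTerm-+ x y zero    = begin-equality
    expTerm x 0 * expTerm y 0  ≈⟨ *-cong (expTerm-0 x) (expTerm-0 y) ⟩
    1# * 1#                    ≈⟨ *-identityʳ 1# ⟩
    1#                         ≈⟨ expTerm-0 (x + y) ⟨
    expTerm (x + y) 0          ∎
  expTerm-+ x y (suc n) = *-cancelʳ (fromℕ-suc≉0 n) (begin-equality
    cauchyProduct X Y (suc n) * n₁
      ≈⟨ solve 2 (λ c m → c :* m := (:0 :+ m) :* c) refl _ n₁ ⟩
    (0# + n₁) * cauchyProduct X Y (suc n)
      ≈⟨ cauchyProduct-leibniz 0# X Y (suc n) ⟨
    cauchyProduct (λ i → (0# + fromℕ i) * X i) Y (suc n) + cauchyProduct X (λ j → fromℕ j * Y j) (suc n)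
      ≈⟨ +-cong left right ⟩
    x * cauchyProduct X Y n + y * cauchyProduct X Y n
      ≈⟨ distribʳ _ x y ⟨
    (x + y) * cauchyProduct X Y n
      ≈⟨ *-congˡ (expTerm-+ x y n) ⟩
    (x + y) * expTerm (x + y) n
      ≈⟨ fromℕ-*-expTerm (x + y) n ⟨
    n₁ * expTerm (x + y) (suc n)
      ≈⟨ *-comm _ _ ⟩
    expTerm (x + y) (suc n) * n₁  ∎)
    where
    X Y : Seq
    X = expTerm x
    Y = expTerm y
    n₁ : Carrier
    n₁ = fromℕ (suc n)
    left : cauchyProduct (λ i → (0# + fromℕ i) * X i) Y (suc n) ≈ x * cauchyProduct X Y n
    left = begin-equality
      (0# + 0#) * X 0 * Y (suc n) + cauchyProduct (λ i → (0# + fromℕ (suc i)) * X (suc i)) Y n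
        ≈⟨ +-cong (solve 2 (λ a b → (:0 :+ :0) :* a :* b := :0) refl _ _)
             (cauchyProduct-congˡ Y (λ i → trans (*-congʳ (+-identityˡ _)) (fromℕ-*-expTerm x i)) n) ⟩
      0# + cauchyProduct (λ i → x * X i) Y n
        ≈⟨ +-identityˡ _ ⟩
      cauchyProduct (λ i → x * X i) Y n
        ≈⟨ cauchyProduct-scaleˡ x X Y n ⟩
      x * cauchyProduct X Y n  ∎
    right : cauchyProduct X (λ j → fromℕ j * Y j) (suc n) ≈ y * cauchyProduct X Y n
    right = begin-equality
      cauchyProduct X (λ j → fromℕ j * Y j) (suc n)
        ≈⟨ cauchyProduct-sucʳ X _ n ⟩
      cauchyProduct X (λ j → fromℕ (suc j) * Y (suc j)) n + X (suc n) * (0# * Y 0)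
        ≈⟨ +-cong (cauchyProduct-congʳ X (fromℕ-*-expTerm y) n)
             (solve 2 (λ a b → a :* (:0 :* b) := :0) refl _ _) ⟩
      cauchyProduct X (λ j → y * Y j) n + 0#
        ≈⟨ +-identityʳ _ ⟩
      cauchyProduct X (λ j → y * Y j) n
        ≈⟨ cauchyProduct-scaleʳ y X Y n ⟩
      y * cauchyProduct X Y n  ∎

  -- The exponential function: functional equation and bounds

  expSeries : Carrier → Seq
  expSeries x = partialSum (expTerm x)

  ∣expTerm∣ : ∀ x k → ∣ expTerm x k ∣ ≤ expTerm ∣ x ∣ k
  ∣expTerm∣ x k = ∣∣-lub (proj₁ (ExpSeries.t-bound x k)) (proj₂ (ExpSeries.t-bound x k))

  triangle-expTerm : ∀ x y N → triangle (expTerm x) (expTerm y) N ≈ expSeries (x + y) N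
  triangle-expTerm x y N = trans (sym (partialSum-cauchyProduct (expTerm x) (expTerm y) N))
    (partialSum-cong (expTerm-+ x y) N)

  -- The error is a corner sum, dominated by the corner for |x| and |y|. There all terms are
  -- nonnegative and the N × N square fits into the triangle of size 2N, so a stretch of a single
  -- Cauchy series remains.
  ∣expSeries-*∣ : ∀ x y N →
    ∣ expSeries x N * expSeries y N - expSeries (x + y) N ∣
      ≤ expSeries (∣ x ∣ + ∣ y ∣) (N ℕ.+ N) - expSeries (∣ x ∣ + ∣ y ∣) N
  ∣expSeries-*∣ x y N = begin
    ∣ expSeries x N * expSeries y N - expSeries (x + y) N ∣
      ≤⟨ ∣∣-lub (≤-respˡ (toCorner x y) (x≤∣x∣ _)) (≤-respˡ (-‿cong (toCorner x y)) (-x≤∣x∣ _)) ⟩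
    ∣ corner (expTerm x) (expTerm y) N N ∣
      ≤⟨ ∣corner∣ (∣expTerm∣ y) (∣expTerm∣ x) N ℕ.≤-refl ⟩
    corner (expTerm ∣ x ∣) (expTerm ∣ y ∣) N N
      ≈⟨ toCorner ∣ x ∣ ∣ y ∣ ⟩
    expSeries (∣ x ∣) N * expSeries (∣ y ∣) N - expSeries (∣ x ∣ + ∣ y ∣) N
      ≤⟨ +-monoˡ-≤ _ (≤-respʳ (triangle-expTerm ∣ x ∣ ∣ y ∣ (N ℕ.+ N))
           (product≤triangle (ExpSeries.0≤A x) (ExpSeries.0≤A y) N N)) ⟩
    expSeries (∣ x ∣ + ∣ y ∣) (N ℕ.+ N) - expSeries (∣ x ∣ + ∣ y ∣) N  ∎
    where
    toCorner : ∀ x y → corner (expTerm x) (expTerm y) N N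
                     ≈ expSeries x N * expSeries y N - expSeries (x + y) N
    toCorner x y = trans (corner≈ (expTerm x) (expTerm y) N N) (+-congˡ (-‿cong (triangle-expTerm x y N)))

  expSeries-*-null : ∀ x y → Null (λ N → expSeries x N * expSeries y N - expSeries (x + y) N)
  expSeries-*-null x y ε 0<ε =
    let N , bound = expSeries-cauchy (∣ x ∣ + ∣ y ∣) ε 0<ε
    in N , λ n N≤n → ≤-trans (∣expSeries-*∣ x y n)
         (≤-trans (x≤∣x∣ _) (proj₁ (bound (n ℕ.+ n) n (ℕ.≤-trans N≤n (ℕ.m≤m+n n n)) N≤n)))

  ∣∣-cong : ∀ {x y} → x ≈ y → ∣ x ∣ ≤ ∣ y ∣
  ∣∣-cong x≈y = ∣∣-lub (≤-respˡ (sym x≈y) (x≤∣x∣ _)) (≤-respˡ (-‿cong (sym x≈y)) (-x≤∣x∣ _))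

  ⟶-neg : ∀ {s : Seq} {l} → s ⟶ l → Null (λ n → l - s n)
  ⟶-neg {s} {l} s⟶l ε 0<ε =
    let N , bound = ⟶⇒null {s} {l} s⟶l ε 0<ε
    in N , λ n N≤n → ≤-trans (∣∣-lub (x-y≤∣y-x∣ _ _)
         (≤-respˡ (solve 2 (λ s l → s :- l := :- (l :- s)) refl (s n) l) (x≤∣x∣ _))) (bound n N≤n)

  expTerm-cong : ∀ {x y} → x ≈ y → ∀ k → expTerm x k ≈ expTerm y k
  expTerm-cong x≈y k = *-congʳ (^-congˡ k x≈y)

  0≤x*x : ∀ x → 0# ≤ x * x
  0≤x*x x = [ (λ 0≤x → *-nonNeg 0≤x 0≤x)
            , (λ x≤0 → ≤-respʳ (-x*-y≈x*y x x) (*-nonNeg (x≤0⇒0≤-x x≤0) (x≤0⇒0≤-x x≤0)))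
            ]′ (≤-total 0# x)

  expTerm-1 : ∀ x → expTerm x 1 ≈ x
  expTerm-1 x = begin-equality
    expTerm x 1              ≈⟨ solve 1 (λ a → a := (:1 :+ :0) :* a) refl _ ⟩
    fromℕ 1 * expTerm x 1    ≈⟨ fromℕ-*-expTerm x 0 ⟩
    x * expTerm x 0          ≈⟨ *-congˡ (expTerm-0 x) ⟩
    x * 1#                   ≈⟨ *-identityʳ x ⟩
    x                        ∎

  0≤expTerm : ∀ {x} → 0# ≤ x → ∀ k → 0# ≤ expTerm x k
  0≤expTerm {x} _ zero   = ≤-respʳ (sym (expTerm-0 x)) 0≤1
  0≤expTerm 0≤x (suc k) = ≤-respʳ (sym (expTerm-suc _ k))
    (*-nonNeg (0≤expTerm 0≤x k) (*-nonNeg 0≤x (0≤fromℕ-suc⁻¹ k)))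

  0≤^ : ∀ {x} → 0# ≤ x → ∀ n → 0# ≤ x ^ n
  0≤^ 0≤x zero    = 0≤1
  0≤^ 0≤x (suc n) = *-nonNeg 0≤x (0≤^ 0≤x n)

  ^-mono-≤ : ∀ {x y} → 0# ≤ x → x ≤ y → ∀ n → x ^ n ≤ y ^ n
  ^-mono-≤ 0≤x x≤y zero    = ≤-refl
  ^-mono-≤ 0≤x x≤y (suc n) = *-mono-≤ (≤-trans 0≤x x≤y) (0≤^ 0≤x n) x≤y (^-mono-≤ 0≤x x≤y n)

  -- With exp a parameter, the conversion checker cannot unfold it to the proof
  -- that its series is Cauchy.
  module ExpLimit (exp : Carrier → Carrier) (exp-converges : ∀ x → expSeries x ⟶ exp x) where

    exp-+ : ∀ x y → exp (x + y) ≈ exp x * exp y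
    exp-+ x y = ≤-antisym (x-y≤0⇒x≤y (≤-trans (≤-respˡ (solve 2 (λ u v → :- (v :- u) := u :- v) refl _ _) (-x≤∣x∣ _)) ∣d∣≤0))
                          (x-y≤0⇒x≤y (≤-trans (x≤∣x∣ _) ∣d∣≤0))
      where
      d : Carrier
      d = exp x * exp y - exp (x + y)
      s s′ s″ : Seq
      s  = expSeries x
      s′ = expSeries y
      s″ = expSeries (x + y)
      -- For every n the constant d is a sum of four null sequences: two replace a limit by its
      -- partial sum in one factor, the third is the multiplication error, and the fourth is the
      -- convergence at x + y. In the first the cofactor varies with n, hence `⟶-bounded`.
      ∣d∣≤0 : ∣ d ∣ ≤ 0#
      ∣d∣≤0 = null-≤⇒≤0 0
        (null-+
          (null-+
            (null-bounded-* (∣ exp x ∣ + 1#) (⟶-bounded {s} (exp-converges x)) (⟶-neg {s′} (exp-converges y)))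
            (null-bounded-* ∣ exp y ∣ (0 , λ _ _ → ≤-refl) (⟶-neg {s} (exp-converges x))))
          (null-+ (expSeries-*-null x y) (⟶⇒null {s″} (exp-converges (x + y)))))
        (λ n _ → ∣∣-cong (solve 6 (λ s s′ s″ l l′ l″ → l :* l′ :- l″ :=
           s :* (l′ :- s′) :+ l′ :* (l :- s) :+ ((s :* s′ :- s″) :+ (s″ :- l″))) refl
           (s n) (s′ n) (s″ n) (exp x) (exp y) (exp (x + y))))

    -- `exp` is known only through convergence, which does not by itself make it respect `≈`;
    -- equality follows by comparing the limits of termwise equal series.
    exp-cong : ∀ {x y} → x ≈ y → exp x ≈ exp y
    exp-cong x≈y = ≤-antisym (exp-≤ x≈y) (exp-≤ (sym x≈y))
      where
      exp-≤ : ∀ {x y} → x ≈ y → exp x ≤ exp y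
      exp-≤ {x} {y} x≈y = limit-mono-≤ {expSeries x} {expSeries y} 0 (exp-converges x) (exp-converges y)
        (λ n _ → ≤-reflexive (partialSum-cong (expTerm-cong x≈y) n))

    -- As the square of exp(x/2), exp x is nonnegative for negative x too, where the terms of the
    -- series alternate in sign.
    0≤exp : ∀ x → 0# ≤ exp x
    0≤exp x = ≤-respʳ (trans (sym (exp-+ _ _)) (exp-cong (x½+x½≈x x))) (0≤x*x (exp (x * ½)))

    1+x≤exp : ∀ {x} → 0# ≤ x → 1# + x ≤ exp x
    1+x≤exp {x} 0≤x = limit-mono-≤ {λ _ → 1# + x} {expSeries x} 2 (const-⟶ (1# + x)) (exp-converges x)
      λ n 2≤n → begin
        1# + x                         ≈⟨ +-cong (trans (+-identityˡ _) (expTerm-0 x)) (expTerm-1 x) ⟨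
        expSeries x 2                  ≤⟨ partialSum-mono (0≤expTerm 0≤x) (ℕ.≤⇒≤′ 2≤n) ⟩
        expSeries x n                  ∎

    -- With t = 2y/(2+y), this is the Padé bound exp t ≤ (2+t)/(2−t).  The terms
    -- tᵏ/k! decay at least by the factor t/2 from k = 1 on, so the tail starting
    -- with the term a is at most a/(1−t/2) = a(1+y/2).
    exp≤1+y : ∀ {t y} → 0# ≤ t → 0# ≤ y → t * (1# + y * ½) ≈ y → exp t ≤ 1# + y
    exp≤1+y {t} {y} 0≤t 0≤y tr≈y = limit-mono-≤ {expSeries t} {λ _ → 1# + y} 1 (exp-converges t) (const-⟶ (1# + y))
      λ { (suc n) _ → ≤-trans (x≤x+y (*-nonNeg (0≤a (suc n)) 0≤r)) (invariant n) }
      where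
      a : Seq
      a = expTerm t
      r : Carrier
      r = 1# + y * ½
      0≤a : ∀ k → 0# ≤ a k
      0≤a = 0≤expTerm 0≤t
      0≤r : 0# ≤ r
      0≤r = +-nonNeg 0≤1 (*-nonNeg 0≤y (proj₁ 0<½))
      decay : ∀ n → a (suc (suc n)) * r ≤ a (suc n) * (y * ½)
      decay n = begin
        a₂ * r                    ≈⟨ x½+x½≈x _ ⟨
        a₂ * r * ½ + a₂ * r * ½   ≈⟨ solve 3 (λ a r h → a :* r :* h :+ a :* r :* h := (:1 :+ (:1 :+ :0)) :* a :* (r :* h)) refl a₂ r ½ ⟩
        fromℕ 2 * a₂ * (r * ½)
          ≤⟨ *-monoˡ-≤ (*-nonNeg 0≤r (proj₁ 0<½))
               (*-monoˡ-≤ (0≤a (suc (suc n))) (fromℕ-mono {2} {suc (suc n)} (ℕ.s≤s (ℕ.s≤s ℕ.z≤n)))) ⟩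
        fromℕ (suc (suc n)) * a₂ * (r * ½)  ≈⟨ *-congʳ (fromℕ-*-expTerm t (suc n)) ⟩
        t * a (suc n) * (r * ½)   ≈⟨ solve 4 (λ t a r h → t :* a :* (r :* h) := a :* (t :* r :* h)) refl t _ r ½ ⟩
        a (suc n) * (t * r * ½)   ≈⟨ *-congˡ (*-congʳ tr≈y) ⟩
        a (suc n) * (y * ½)       ∎
        where
        a₂ : Carrier
        a₂ = a (suc (suc n))
      -- Partial sum plus tail bound does not increase with n, by `decay` and r = 1 + y/2; at n = 0
      -- it is exactly 1 + tr = 1 + y.
      invariant : ∀ n → expSeries t (suc n) + a (suc n) * r ≤ 1# + y
      invariant zero    = ≤-reflexive (+-cong (trans (+-identityˡ _) (expTerm-0 t))
        (trans (*-congʳ (expTerm-1 t)) tr≈y))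
      invariant (suc n) = begin
        e + a₁ + a (suc (suc n)) * r  ≤⟨ +-monoʳ-≤ _ (decay n) ⟩
        e + a₁ + a₁ * (y * ½)         ≈⟨ solve 3 (λ e a z → e :+ a :+ a :* z := e :+ a :* (:1 :+ z)) refl e a₁ (y * ½) ⟩
        e + a₁ * r                    ≤⟨ invariant n ⟩
        1# + y                        ∎
        where
        e a₁ : Carrier
        e  = expSeries t (suc n)
        a₁ = a (suc n)

    [1+x]^n≤exp : ∀ {x} → 0# ≤ x → ∀ n → (1# + x) ^ n ≤ exp (fromℕ n * x)
    [1+x]^n≤exp {x} 0≤x zero    = begin
      1#              ≈⟨ +-identityʳ 1# ⟨
      1# + 0#         ≤⟨ 1+x≤exp ≤-refl ⟩
      exp 0#          ≈⟨ exp-cong (zeroˡ x) ⟨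
      exp (0# * x)    ∎
    [1+x]^n≤exp {x} 0≤x (suc n) = begin
      (1# + x) * (1# + x) ^ n   ≤⟨ *-mono-≤ (0≤exp x) (0≤^ (+-nonNeg 0≤1 0≤x) n) (1+x≤exp 0≤x) ([1+x]^n≤exp 0≤x n) ⟩
      exp x * exp (fromℕ n * x) ≈⟨ exp-+ x _ ⟨
      exp (x + fromℕ n * x)     ≈⟨ exp-cong (solve 2 (λ n x → x :+ n :* x := (:1 :+ n) :* x) refl (fromℕ n) x) ⟩
      exp (fromℕ (suc n) * x)   ∎

    exp≤^ : ∀ {t z} → exp t ≤ z → ∀ n → exp (fromℕ n * t) ≤ z ^ n
    exp≤^ {t} {z} exp≤z zero    = begin
      exp (0# * t)  ≈⟨ exp-cong (zeroˡ t) ⟩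
      -- At t = y = 0 the Padé bound supplies exp 0 ≤ 1.
      exp 0#        ≤⟨ exp≤1+y ≤-refl ≤-refl (zeroˡ _) ⟩
      1# + 0#       ≈⟨ +-identityʳ 1# ⟩
      1#            ∎
    exp≤^ {t} {z} exp≤z (suc n) = begin
      exp (fromℕ (suc n) * t)     ≈⟨ exp-cong (solve 2 (λ n x → (:1 :+ n) :* x := x :+ n :* x) refl (fromℕ n) t) ⟩
      exp (t + fromℕ n * t)       ≈⟨ exp-+ t _ ⟩
      exp t * exp (fromℕ n * t)   ≤⟨ *-mono-≤ (≤-trans (0≤exp t) exp≤z) (0≤exp _) exp≤z (exp≤^ exp≤z n) ⟩
      z * z ^ n                   ∎

-- Expectations over finite distributions

module Expectation {c ℓ₁ ℓ₂} (ℝ : RealField c ℓ₁ ℓ₂) where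
  open HashCounting ℝ hiding (exp)
  open RealProperties ℝ
  open import Algebra.Properties.Semiring.Exp semiring using (^-homo-*)
  open import Relation.Binary.Reasoning.PartialOrder
    (DecTotalOrder.poset decTotalOrder)

  private
    variable
      a b p : Level
      X Z : Set a

  𝟙 : Bool → Carrier
  𝟙 b = if b then 1# else 0#

  0≤𝟙 : ∀ b → 0# ≤ 𝟙 b
  0≤𝟙 true  = 0≤1
  0≤𝟙 false = ≤-refl

  𝟙-∧ : ∀ b b′ → 𝟙 (b ∧ b′) ≈ 𝟙 b * 𝟙 b′
  𝟙-∧ true  b′ = sym (*-identityˡ _)
  𝟙-∧ false b′ = sym (zeroˡ _)

  𝔼 : Dist X → (X → Carrier) → Carrier
  𝔼 []            g = 0#
  𝔼 ((x , p) ∷ d) g = p * g x + 𝔼 d g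

  Pr≈𝔼 : {P : Pred X p} (d : Dist X) (P? : Decidable P) → Pr d P? ≈ 𝔼 d (λ x → 𝟙 (does (P? x)))
  Pr≈𝔼 []            P? = refl
  Pr≈𝔼 ((x , p) ∷ d) P? = +-cong (if≈*𝟙 (does (P? x))) (Pr≈𝔼 d P?)
    where
    if≈*𝟙 : ∀ b → (if b then p else 0#) ≈ p * 𝟙 b
    if≈*𝟙 true  = sym (*-identityʳ p)
    if≈*𝟙 false = sym (zeroʳ p)

  𝔼-cong : ∀ (d : Dist X) {g h} → (∀ x → g x ≈ h x) → 𝔼 d g ≈ 𝔼 d h
  𝔼-cong []            g≈h = refl
  𝔼-cong ((x , p) ∷ d) g≈h = +-cong (*-congˡ (g≈h x)) (𝔼-cong d g≈h)

  𝔼-+ : ∀ (d : Dist X) g h → 𝔼 d (λ x → g x + h x) ≈ 𝔼 d g + 𝔼 d h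
  𝔼-+ []            g h = sym (+-identityʳ 0#)
  𝔼-+ ((x , p) ∷ d) g h = trans (+-congˡ (𝔼-+ d g h))
    (solve 5 (λ p g h s t → p :* (g :+ h) :+ (s :+ t) := (p :* g :+ s) :+ (p :* h :+ t)) refl
      p (g x) (h x) (𝔼 d g) (𝔼 d h))

  𝔼-*ˡ : ∀ (d : Dist X) k g → 𝔼 d (λ x → k * g x) ≈ k * 𝔼 d g
  𝔼-*ˡ []            k g = sym (zeroʳ k)
  𝔼-*ˡ ((x , p) ∷ d) k g = trans (+-congˡ (𝔼-*ˡ d k g))
    (solve 4 (λ p k g s → p :* (k :* g) :+ k :* s := k :* (p :* g :+ s)) refl p k (g x) (𝔼 d g))

  𝔼-*ʳ : ∀ (d : Dist X) k g → 𝔼 d (λ x → g x * k) ≈ 𝔼 d g * k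
  𝔼-*ʳ d k g = trans (𝔼-cong d (λ x → *-comm (g x) k)) (trans (𝔼-*ˡ d k g) (*-comm k _))

  𝔼-++ : ∀ (d e : Dist X) g → 𝔼 (d ++ e) g ≈ 𝔼 d g + 𝔼 e g
  𝔼-++ []            e g = sym (+-identityˡ _)
  𝔼-++ ((x , p) ∷ d) e g = trans (+-congˡ (𝔼-++ d e g)) (sym (+-assoc _ _ _))

  𝔼-scale : ∀ p (d : Dist X) g → 𝔼 (List.map (map₂ (p *_)) d) g ≈ p * 𝔼 d g
  𝔼-scale p []            g = sym (zeroʳ p)
  𝔼-scale p ((x , q) ∷ d) g = trans (+-cong (*-assoc p q (g x)) (𝔼-scale p d g)) (sym (distribˡ p _ _))

  𝔼-return : ∀ (x : X) g → 𝔼 (return x) g ≈ g x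
  𝔼-return x g = trans (+-identityʳ _) (*-identityˡ (g x))

  𝔼->>= : ∀ (d : Dist X) (k : X → Dist Z) g → 𝔼 (d >>= k) g ≈ 𝔼 d (λ x → 𝔼 (k x) g)
  𝔼->>= []            k g = refl
  𝔼->>= ((x , p) ∷ d) k g = trans (𝔼-++ (List.map (map₂ (p *_)) (k x)) (d >>= k) g)
    (+-cong (𝔼-scale p (k x) g) (𝔼->>= d k g))

  𝔼-iid-suc : ∀ n (d : Dist X) g → 𝔼 (iid (suc n) d) g ≈ 𝔼 d (λ x → 𝔼 (iid n d) (λ xs → g (x ∷ xs)))
  𝔼-iid-suc n d g = trans
    (𝔼->>= d (λ x → iid n d >>= λ xs → return (x ∷ xs)) g) (𝔼-cong d λ x →
    trans (𝔼->>= (iid n d) (λ xs → return (x ∷ xs)) g) (𝔼-cong (iid n d) λ xs → 𝔼-return (x ∷ xs) g))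

  -- A `Dist` may carry arbitrary weights. Monotonicity stands in for their nonnegativity; phrased
  -- through `𝔼`, both conditions pass through `_>>=_` by `𝔼->>=`.
  record IsProbability {a} {X : Set a} (d : Dist X) : Set (a Level.⊔ c Level.⊔ ℓ₁ Level.⊔ ℓ₂) where
    field
      𝔼-mono : ∀ {g h} → (∀ x → g x ≤ h x) → 𝔼 d g ≤ 𝔼 d h
      𝔼-1    : 𝔼 d (λ _ → 1#) ≈ 1#

    𝔼-const : ∀ k → 𝔼 d (λ _ → k) ≈ k
    𝔼-const k = begin-equality
      𝔼 d (λ _ → k)       ≈⟨ 𝔼-cong d (λ _ → sym (*-identityʳ k)) ⟩
      𝔼 d (λ _ → k * 1#)  ≈⟨ 𝔼-*ˡ d k (λ _ → 1#) ⟩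
      k * 𝔼 d (λ _ → 1#)  ≈⟨ *-congˡ 𝔼-1 ⟩
      k * 1#              ≈⟨ *-identityʳ k ⟩
      k                   ∎

  open IsProbability

  return-isProbability : (x : X) → IsProbability (return x)
  return-isProbability x = record
    { 𝔼-mono = λ {g} {h} g≤h → ≤-respˡ (sym (𝔼-return x g)) (≤-respʳ (sym (𝔼-return x h)) (g≤h x))
    ; 𝔼-1    = 𝔼-return x (λ _ → 1#)
    }

  >>=-isProbability : {d : Dist X} {k : X → Dist Z} → IsProbability d →
                      (∀ x → IsProbability (k x)) → IsProbability (d >>= k)
  >>=-isProbability {d = d} {k} d-prob k-prob = record
    { 𝔼-mono = λ {g} {h} g≤h → ≤-respˡ (sym (𝔼->>= d k g)) (≤-respʳ (sym (𝔼->>= d k h))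
        (𝔼-mono d-prob λ x → 𝔼-mono (k-prob x) g≤h))
    ; 𝔼-1    = trans (𝔼->>= d k _) (trans (𝔼-cong d λ x → 𝔼-1 (k-prob x)) (𝔼-1 d-prob))
    }

  iid-isProbability : ∀ n {d : Dist X} → IsProbability d → IsProbability (iid n d)
  iid-isProbability zero    d-prob = return-isProbability []
  iid-isProbability (suc n) d-prob = >>=-isProbability d-prob λ x →
    >>=-isProbability (iid-isProbability n d-prob) λ xs → return-isProbability (x ∷ xs)

  bernoulli-isProbability : ∀ {f} → 0# ≤ f → f ≤ 1# → IsProbability (bernoulli f)
  bernoulli-isProbability {f} 0≤f f≤1 = record
    { 𝔼-mono = λ g≤h → +-mono-≤ (*-monoʳ-≤ 0≤f (g≤h 1F))
        (+-monoˡ-≤ 0# (*-monoʳ-≤ (x≤y⇒0≤y-x f≤1) (g≤h 0F)))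
    ; 𝔼-1    = solve 1 (λ f → f :* :1 :+ ((:1 :- f) :* :1 :+ :0) := :1) refl f
    }

  -- Uniformity of a single hash value

  ½≤1 : ½ ≤ 1#
  ½≤1 = ≤-respʳ ½+½≈1 (x≤x+y (proj₁ 0<½))

  2^*½^≈1 : ∀ m → 2# ^ m * ½ ^ m ≈ 1#
  2^*½^≈1 zero    = *-identityʳ 1#
  2^*½^≈1 (suc m) = begin-equality
    2# * 2# ^ m * (½ * ½ ^ m)  ≈⟨ solve 3 (λ h u v → (:1 :+ :1) :* u :* (h :* v) := (h :+ h) :* (u :* v)) refl ½ (2# ^ m) (½ ^ m) ⟩
    (½ + ½) * (2# ^ m * ½ ^ m) ≈⟨ *-cong ½+½≈1 (2^*½^≈1 m) ⟩
    1# * 1#                    ≈⟨ *-identityʳ 1# ⟩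
    1#                         ∎

  uniform : IsProbability (bernoulli ½)
  uniform = bernoulli-isProbability (proj₁ 0<½) ½≤1

  ℋ-isProbability : ∀ {f} m n → 0# ≤ f → f ≤ ½ → IsProbability (ℋ f m n)
  ℋ-isProbability m n 0≤f f≤½ =
    >>=-isProbability (iid-isProbability m (iid-isProbability n
      (bernoulli-isProbability 0≤f (≤-trans f≤½ ½≤1)))) λ A →
    >>=-isProbability (iid-isProbability m uniform) λ b → return-isProbability (affine A b)

  -- A uniform bit matches the parity of r with probability 1/2. Only r = 0 and r = 1 need a
  -- calculation, because (r + 2 + b) mod 2 computes to (r + b) mod 2.
  uniform-parity : ∀ r → 𝔼 (bernoulli ½) (λ b → 𝟙 (does ((r ℕ.+ toℕ b) mod 2 Fin.≟ 0F))) ≈ ½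
  uniform-parity 0             = begin-equality
    ½ * 0# + ((1# - ½) * 1# + 0#)  ≈⟨ solve 1 (λ h → h :* :0 :+ ((:1 :- h) :* :1 :+ :0) := :1 :- h) refl ½ ⟩
    1# - ½                         ≈⟨ +-congʳ ½+½≈1 ⟨
    ½ + ½ - ½                      ≈⟨ solve 1 (λ h → h :+ h :- h := h) refl ½ ⟩
    ½                              ∎
  uniform-parity 1             =
    solve 1 (λ h → h :* :1 :+ ((:1 :- h) :* :0 :+ :0) := h) refl ½
  uniform-parity (suc (suc r)) = uniform-parity r

  maps-to-0? : ∀ {m n} (x : Bits n) (h : Hash m n) → Dec (h x ≡ Vec.replicate m 0F)
  maps-to-0? {m} x h = Vec.≡-dec Fin._≟_ (h x) (Vec.replicate m 0F)

  -- With A fixed, each bit of b randomizes the parity of its own row, so the m coordinates of the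
  -- hash value are independent fair bits.
  𝔼-affine : ∀ {m n} (A : Matrix m n) x →
    𝔼 (iid m (bernoulli ½)) (λ b → 𝟙 (does (maps-to-0? x (affine A b)))) ≈ ½ ^ m
  𝔼-affine []        x = 𝔼-return {X = Bits 0} [] (λ _ → 1#)
  𝔼-affine {suc m} (row ∷ A) x = begin-equality
    𝔼 (iid (suc m) (bernoulli ½)) (λ b → 𝟙 (does (maps-to-0? x (affine (row ∷ A) b))))
      ≈⟨ 𝔼-iid-suc m (bernoulli ½) _ ⟩
    𝔼 (bernoulli ½) (λ b → 𝔼 (iid m (bernoulli ½)) (λ bs → 𝟙 (zero? b ∧ zeros? bs)))
      ≈⟨ 𝔼-cong (bernoulli ½) (λ b → trans
           (𝔼-cong (iid m (bernoulli ½)) (λ bs → 𝟙-∧ (zero? b) (zeros? bs)))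
           (𝔼-*ˡ (iid m (bernoulli ½)) (𝟙 (zero? b)) (λ bs → 𝟙 (zeros? bs)))) ⟩
    𝔼 (bernoulli ½) (λ b → 𝟙 (zero? b) * 𝔼 (iid m (bernoulli ½)) (λ bs → 𝟙 (zeros? bs)))
      ≈⟨ 𝔼-*ʳ (bernoulli ½) _ (λ b → 𝟙 (zero? b)) ⟩
    𝔼 (bernoulli ½) (λ b → 𝟙 (zero? b)) * 𝔼 (iid m (bernoulli ½)) (λ bs → 𝟙 (zeros? bs))
      ≈⟨ *-cong (uniform-parity (row ∙ x)) (𝔼-affine A x) ⟩
    ½ * ½ ^ m  ∎
    where
    zero? : Bit → Bool
    zero? b = does (((row ∙ x) ℕ.+ toℕ b) mod 2 Fin.≟ 0F)
    zeros? : Bits m → Bool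
    zeros? bs = does (maps-to-0? x (affine A bs))

  𝔼-ℋ : ∀ {f} m n → 0# ≤ f → f ≤ ½ → ∀ x →
    𝔼 (ℋ f m n) (λ h → 𝟙 (does (maps-to-0? x h))) ≈ ½ ^ m
  𝔼-ℋ {f} m n 0≤f f≤½ x = begin-equality
    𝔼 (ℋ f m n) g
      ≈⟨ 𝔼->>= matrices (λ A → iid m (bernoulli ½) >>= λ b → return (affine A b)) g ⟩
    𝔼 matrices (λ A → 𝔼 (iid m (bernoulli ½) >>= λ b → return (affine A b)) g)
      ≈⟨ 𝔼-cong matrices (λ A → trans (𝔼->>= (iid m (bernoulli ½)) (λ b → return (affine A b)) g)
           (trans (𝔼-cong (iid m (bernoulli ½)) (λ b → 𝔼-return (affine A b) g)) (𝔼-affine A x))) ⟩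
    𝔼 matrices (λ _ → ½ ^ m)
      ≈⟨ 𝔼-const (iid-isProbability m (iid-isProbability n
           (bernoulli-isProbability 0≤f (≤-trans f≤½ ½≤1)))) _ ⟩
    ½ ^ m  ∎
    where
    g : Hash m n → Carrier
    g h = 𝟙 (does (maps-to-0? x h))
    matrices : Dist (Matrix m n)
    matrices = iid m (iid n (bernoulli f))

  -- Expected number of zeros and Markov's inequality

  fromℕ-length-filter : ∀ {P : Pred X p} (P? : Decidable P) x xs →
    fromℕ (List.length (List.filter P? (x ∷ xs))) ≈ 𝟙 (does (P? x)) + fromℕ (List.length (List.filter P? xs))
  fromℕ-length-filter P? x xs with does (P? x)
  ... | true  = refl
  ... | false = sym (+-identityˡ _)

  module _ {f : Carrier} {m n : ℕ} {S : Pred (Bits n) p} (S? : Decidable S) (0≤f : 0# ≤ f) (f≤½ : f ≤ ½) where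

    𝔼-countZeros : 𝔼 (ℋ f m n) (λ h → fromℕ (countZeros S? h)) ≈ fromℕ (card S?) * ½ ^ m
    𝔼-countZeros = go (allBits n)
      where
      H : Dist (Hash m n)
      H = ℋ f m n
      -- Linearity of expectation, by induction on an arbitrary list of points in place of
      -- `allBits n`.
      go : ∀ xs → 𝔼 H (λ h → fromℕ (List.length (List.filter (λ x → S? x ×-dec maps-to-0? x h) xs)))
                  ≈ fromℕ (List.length (List.filter S? xs)) * ½ ^ m
      go []       = trans (𝔼-const (ℋ-isProbability m n 0≤f f≤½) 0#) (sym (zeroˡ _))
      go (x ∷ xs) = begin-equality
        𝔼 H (λ h → fromℕ (List.length (List.filter (λ x → S? x ×-dec maps-to-0? x h) (x ∷ xs))))
          ≈⟨ 𝔼-cong H (λ h → trans (fromℕ-length-filter (λ x → S? x ×-dec maps-to-0? x h) x xs)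
               (+-congʳ (𝟙-∧ s (does (maps-to-0? x h))))) ⟩
        𝔼 H (λ h → 𝟙 s * 𝟙 (does (maps-to-0? x h)) + rest h)
          ≈⟨ 𝔼-+ H (λ h → 𝟙 s * 𝟙 (does (maps-to-0? x h))) rest ⟩
        𝔼 H (λ h → 𝟙 s * 𝟙 (does (maps-to-0? x h))) + 𝔼 H rest
          ≈⟨ +-cong (trans (𝔼-*ˡ H (𝟙 s) (λ h → 𝟙 (does (maps-to-0? x h)))) (*-congˡ (𝔼-ℋ m n 0≤f f≤½ x)))
               (go xs) ⟩
        𝟙 s * ½ ^ m + fromℕ (List.length (List.filter S? xs)) * ½ ^ m
          ≈⟨ distribʳ _ _ _ ⟨
        (𝟙 s + fromℕ (List.length (List.filter S? xs))) * ½ ^ m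
          ≈⟨ *-congʳ (fromℕ-length-filter S? x xs) ⟨
        fromℕ (List.length (List.filter S? (x ∷ xs))) * ½ ^ m  ∎
        where
        s : Bool
        s = does (S? x)
        rest : Hash m n → Carrier
        rest h = fromℕ (List.length (List.filter (λ x → S? x ×-dec maps-to-0? x h) xs))

    Pr-nonempty≤ : Pr (ℋ f m n) (λ h → 1 ℕ.≤? countZeros S? h) ≤ fromℕ (card S?) * ½ ^ m
    Pr-nonempty≤ = begin
      Pr (ℋ f m n) (λ h → 1 ℕ.≤? countZeros S? h)
        ≈⟨ Pr≈𝔼 (ℋ f m n) (λ h → 1 ℕ.≤? countZeros S? h) ⟩
      𝔼 (ℋ f m n) (λ h → 𝟙 (does (1 ℕ.≤? countZeros S? h)))
        ≤⟨ 𝔼-mono (ℋ-isProbability m n 0≤f f≤½) (λ h → 𝟙≤fromℕ (countZeros S? h)) ⟩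
      𝔼 (ℋ f m n) (λ h → fromℕ (countZeros S? h))
        ≈⟨ 𝔼-countZeros ⟩
      fromℕ (card S?) * ½ ^ m  ∎
      where
      -- Markov's inequality at threshold 1 is this pointwise bound under the expectation.
      𝟙≤fromℕ : ∀ k → 𝟙 (does (1 ℕ.≤? k)) ≤ fromℕ k
      𝟙≤fromℕ zero    = ≤-refl
      𝟙≤fromℕ (suc k) = 1≤fromℕ k

  -- Generating function of the number of successes

  successes : ∀ {P : Pred X p} {T} → Decidable P → Vec X T → ℕ
  successes P? xs = Vec.sum (Vec.map (λ x → if does (P? x) then 1 else 0) xs)

  -- On the values 0 and 1 the power (1+κ)^y is the affine function 1 + κy, so one sample
  -- contributes 1 + κp, and independence multiplies the contributions.
  𝔼-^successes : ∀ {P : Pred X p} {d} → IsProbability d → (P? : Decidable P) → ∀ κ T →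
    𝔼 (iid T d) (λ xs → (1# + κ) ^ successes P? xs) ≈ (1# + κ * Pr d P?) ^ T
  𝔼-^successes {X = X} d-prob P? κ zero    = 𝔼-return {X = Vec X 0} [] (λ _ → 1#)
  𝔼-^successes {d = d} d-prob P? κ (suc T) = begin-equality
    𝔼 (iid (suc T) d) (λ xs → z ^ successes P? xs)
      ≈⟨ 𝔼-iid-suc T d (λ xs → z ^ successes P? xs) ⟩
    𝔼 d (λ x → 𝔼 (iid T d) (λ xs → z ^ (y x ℕ.+ successes P? xs)))
      ≈⟨ 𝔼-cong d (λ x → trans (𝔼-cong (iid T d) (λ xs → ^-homo-* z (y x) (successes P? xs)))
           (𝔼-*ˡ (iid T d) (z ^ y x) (λ xs → z ^ successes P? xs))) ⟩
    𝔼 d (λ x → z ^ y x * 𝔼 (iid T d) (λ xs → z ^ successes P? xs))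
      ≈⟨ 𝔼-*ʳ d _ (λ x → z ^ y x) ⟩
    𝔼 d (λ x → z ^ y x) * 𝔼 (iid T d) (λ xs → z ^ successes P? xs)
      ≈⟨ *-cong single (𝔼-^successes d-prob P? κ T) ⟩
    (1# + κ * Pr d P?) * (1# + κ * Pr d P?) ^ T  ∎
    where
    z : Carrier
    z = 1# + κ
    y : _ → ℕ
    y x = if does (P? x) then 1 else 0
    z^≈ : ∀ b → z ^ (if b then 1 else 0) ≈ 1# + κ * 𝟙 b
    z^≈ true  = solve 1 (λ κ → (:1 :+ κ) :* :1 := :1 :+ κ :* :1) refl κ
    z^≈ false = solve 1 (λ κ → :1 := :1 :+ κ :* :0) refl κ
    single : 𝔼 d (λ x → z ^ y x) ≈ 1# + κ * Pr d P?
    single = begin-equality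
      𝔼 d (λ x → z ^ y x)                                    ≈⟨ 𝔼-cong d (λ x → z^≈ (does (P? x))) ⟩
      𝔼 d (λ x → 1# + κ * 𝟙 (does (P? x)))                   ≈⟨ 𝔼-+ d (λ _ → 1#) (λ x → κ * 𝟙 (does (P? x))) ⟩
      𝔼 d (λ _ → 1#) + 𝔼 d (λ x → κ * 𝟙 (does (P? x)))
        ≈⟨ +-cong (𝔼-1 d-prob) (trans (𝔼-*ˡ d κ (λ x → 𝟙 (does (P? x)))) (*-congˡ (sym (Pr≈𝔼 d P?)))) ⟩
      1# + κ * Pr d P?                                       ∎

  𝔼-nonNeg : {d : Dist X} → IsProbability d → ∀ {g} → (∀ x → 0# ≤ g x) → 0# ≤ 𝔼 d g
  𝔼-nonNeg d-prob 0≤g = ≤-respˡ (𝔼-const d-prob 0#) (𝔼-mono d-prob 0≤g)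

  -- The Chernoff bound

  module Chernoff (exp : Carrier → Carrier) (exp-converges : ∀ x → expSeries x ⟶ exp x)
                  {κ c : Carrier} (0<κ : 0# < κ) (0<c : 0# < c) where
    open ExpLimit exp exp-converges

    -- Here t is 2κ/(2+κ), written so that `t * r ≈ κ` is the hypothesis of `exp≤1+y`.
    r t q : Carrier
    r = 1# + κ * ½
    t = κ / r
    q = c / (1# + κ)

    0≤κ : 0# ≤ κ
    0≤κ = proj₁ 0<κ

    0<1+κ : 0# < 1# + κ
    0<1+κ = 1≤⇒0< (x≤x+y 0≤κ)

    0<2+κ : 0# < 2# + κ
    0<2+κ = 1≤⇒0< (≤-trans (x≤x+y 0≤1) (x≤x+y 0≤κ))

    0<r : 0# < r
    0<r = 1≤⇒0< (x≤x+y (*-nonNeg 0≤κ (proj₁ 0<½)))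

    0≤t : 0# ≤ t
    0≤t = proj₁ (0<* 0<κ (0<⁻¹ 0<r))

    0≤q : 0# ≤ q
    0≤q = proj₁ (0<* 0<c (0<⁻¹ 0<1+κ))

    t*r≈κ : t * r ≈ κ
    t*r≈κ = /-*-cancel κ (0<⇒≉0 0<r)

    -- Clearing denominators by q(1+κ) = c and t(2+κ) = 2κ leaves 2κ(1+κ) - κ(2+κ) = κ².
    exponent : ∀ T → T * (κ * q) - t * (c * T) ≈ - ((κ ^ 2 * c * T) / ((1# + κ) * (2# + κ)))
    exponent T = trans (solve 2 (λ u v → u :- v := :- (v :- u)) refl _ _)
      (-‿cong (*-cancelʳ v≉0 (trans lhs (sym (/-*-cancel _ v≉0)))))
      where
      v≉0 : ¬ (1# + κ) * (2# + κ) ≈ 0#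
      v≉0 = 0<⇒≉0 (0<* 0<1+κ 0<2+κ)
      t*2+κ : t * (2# + κ) ≈ κ + κ
      t*2+κ = begin-equality
        t * (2# + κ)                ≈⟨ *-congˡ (+-congˡ (x½+x½≈x κ)) ⟨
        t * (2# + (κ * ½ + κ * ½))  ≈⟨ solve 2 (λ t u → t :* ((:1 :+ :1) :+ (u :+ u)) := t :* (:1 :+ u) :+ t :* (:1 :+ u)) refl t (κ * ½) ⟩
        t * r + t * r               ≈⟨ +-cong t*r≈κ t*r≈κ ⟩
        κ + κ                       ∎
      lhs : (t * (c * T) - T * (κ * q)) * ((1# + κ) * (2# + κ)) ≈ κ ^ 2 * c * T
      lhs = begin-equality
        (t * (c * T) - T * (κ * q)) * ((1# + κ) * (2# + κ))
          ≈⟨ solve 7 (λ t c T κ q u v → (t :* (c :* T) :- T :* (κ :* q)) :* (u :* v)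
               := t :* v :* (c :* T :* u) :- T :* κ :* v :* (q :* u)) refl t c T κ q (1# + κ) (2# + κ) ⟩
        t * (2# + κ) * (c * T * (1# + κ)) - T * κ * (2# + κ) * (q * (1# + κ))
          ≈⟨ +-cong (*-congʳ t*2+κ) (-‿cong (*-congˡ (/-*-cancel c (0<⇒≉0 0<1+κ)))) ⟩
        (κ + κ) * (c * T * (1# + κ)) - T * κ * (2# + κ) * c
          ≈⟨ solve 3 (λ κ c T → (κ :+ κ) :* (c :* T :* (:1 :+ κ)) :- T :* κ :* ((:1 :+ :1) :+ κ) :* c
               := κ :* (κ :* :1) :* c :* T) refl κ c T ⟩
        κ ^ 2 * c * T  ∎

    -- What depends on k becomes a power, whose mean `𝔼-^successes` computes exactly; `exp` survives
    -- only in a constant factor.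
    exponential-weight : ∀ s k → 𝟙 (does (s ≤? fromℕ k)) ≤ (1# + κ) ^ k * exp (- (t * s))
    exponential-weight s k with s ≤? fromℕ k
    ... | no  _   = *-nonNeg (0≤^ (proj₁ 0<1+κ) k) (0≤exp _)
    ... | yes s≤k = begin
      1#                                   ≤⟨ x≤x+y 0≤tk-ts ⟩
      1# + t * (fromℕ k - s)               ≤⟨ 1+x≤exp 0≤tk-ts ⟩
      exp (t * (fromℕ k - s))              ≈⟨ exp-cong (solve 3 (λ t k s → t :* (k :- s) := k :* t :+ :- (t :* s)) refl t (fromℕ k) s) ⟩
      exp (fromℕ k * t + - (t * s))        ≈⟨ exp-+ _ _ ⟩
      exp (fromℕ k * t) * exp (- (t * s))  ≤⟨ *-monoˡ-≤ (0≤exp _) (exp≤^ (exp≤1+y 0≤t 0≤κ t*r≈κ) k) ⟩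
      (1# + κ) ^ k * exp (- (t * s))       ∎
      where
      0≤tk-ts : 0# ≤ t * (fromℕ k - s)
      0≤tk-ts = *-nonNeg 0≤t (x≤y⇒0≤y-x s≤k)

    chernoff : ∀ {P : Pred X p} {d} → IsProbability d → (P? : Decidable P) → ∀ T → Pr d P? ≤ q →
      𝔼 (iid T d) (λ xs → 𝟙 (does (c * fromℕ T ≤? fromℕ (successes P? xs))))
        ≤ exp (- ((κ ^ 2 * c * fromℕ T) / ((1# + κ) * (2# + κ))))
    chernoff {d = d} d-prob P? T p≤q = begin
      𝔼 (iid T d) (λ xs → 𝟙 (does (s ≤? fromℕ (successes P? xs))))
        ≤⟨ 𝔼-mono (iid-isProbability T d-prob) (λ xs → exponential-weight s (successes P? xs)) ⟩
      𝔼 (iid T d) (λ xs → (1# + κ) ^ successes P? xs * exp (- (t * s)))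
        ≈⟨ 𝔼-*ʳ (iid T d) _ (λ xs → (1# + κ) ^ successes P? xs) ⟩
      𝔼 (iid T d) (λ xs → (1# + κ) ^ successes P? xs) * exp (- (t * s))
        ≈⟨ *-congʳ (𝔼-^successes d-prob P? κ T) ⟩
      (1# + κ * Pr d P?) ^ T * exp (- (t * s))
        ≤⟨ *-monoˡ-≤ (0≤exp _) (≤-trans
             (^-mono-≤ (+-nonNeg 0≤1 (*-nonNeg 0≤κ 0≤p)) (+-monoʳ-≤ 1# (*-monoʳ-≤ 0≤κ p≤q)) T)
             ([1+x]^n≤exp (*-nonNeg 0≤κ 0≤q) T)) ⟩
      exp (fromℕ T * (κ * q)) * exp (- (t * s))
        ≈⟨ exp-+ _ _ ⟨
      exp (fromℕ T * (κ * q) - t * s)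
        ≈⟨ exp-cong (exponent (fromℕ T)) ⟩
      exp (- ((κ ^ 2 * c * fromℕ T) / ((1# + κ) * (2# + κ))))  ∎
      where
      s : Carrier
      s = c * fromℕ T
      0≤p : 0# ≤ Pr d P?
      0≤p = ≤-respʳ (sym (Pr≈𝔼 d P?)) (𝔼-nonNeg d-prob λ x → 0≤𝟙 (does (P? x)))

    -- Failure of the estimated lower bound

    module _ {m n T : ℕ} {S : Pred (Bits n) p} (S? : Decidable S) where

      private
        N : Carrier
        N = fromℕ (card S?)

      ℬ-≤ : 2# ^ m * c / (1# + κ) ≤ N → ∀ (hs : Vec (Hash m n) T) → ℬ S? κ c hs ≤ N
      ℬ-≤ bound≤N hs with does (c ≤? Pr-est S? hs)
      ... | true  = bound≤N
      ... | false = 0≤fromℕ (card S?)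

      ℬ-≰ : ∀ (hs : Vec (Hash m n) T) → ¬ ℬ S? κ c hs ≤ N → c ≤ Pr-est S? hs
      ℬ-≰ hs ℬ≰N with c ≤? Pr-est S? hs
      ... | yes c≤est = c≤est
      ... | no  _     = contradiction (0≤fromℕ (card S?)) ℬ≰N

      -- In indicator form: if `ℬ` exceeds N, it is not its default 0, so c ≤ Y/T; as T ≥ 1,
      -- multiplying by T gives cT ≤ Y.
      failure≤ : 1 ℕ.≤ T → ∀ (hs : Vec (Hash m n) T) →
        1# - 𝟙 (does (c * fromℕ T ≤? fromℕ (Y S? hs))) ≤ 𝟙 (does (ℬ S? κ c hs ≤? N))
      failure≤ (ℕ.s≤s {n = T′} _) hs with ℬ S? κ c hs ≤? N | c * fromℕ T ≤? fromℕ (Y S? hs)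
      ... | yes _   | yes _ = ≤-respˡ (sym (-‿inverseʳ 1#)) 0≤1
      ... | yes _   | no _  = ≤-reflexive (solve 0 (:1 :- :0 := :1) refl)
      ... | no _    | yes _ = ≤-reflexive (-‿inverseʳ 1#)
      ... | no ℬ≰N  | no cT≰Y = contradiction cT≤Y cT≰Y
        where
        cT≤Y : c * fromℕ T ≤ fromℕ (Y S? hs)
        cT≤Y = begin
          c * fromℕ T                ≤⟨ *-monoˡ-≤ (0≤fromℕ T) (ℬ-≰ hs ℬ≰N) ⟩
          Pr-est S? hs * fromℕ T     ≈⟨ /-*-cancel _ (fromℕ-suc≉0 T′) ⟩
          fromℕ (Y S? hs)            ∎

      -- The exponent is a variable `e`, tied to its formula by `≈` only, so the caller may pass it
      -- in whatever syntactic form its own goal contains.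
      lower-bound : ∀ {f e} → 1 ℕ.≤ T → 0# ≤ f → f ≤ ½ →
        e ≈ - ((κ ^ 2 * c * fromℕ T) / ((1# + κ) * (2# + κ))) →
        1# - exp e ≤ Pr (iid T (ℋ f m n)) (λ hs → ℬ S? κ c hs ≤? N)
      lower-bound {f} 1≤T 0≤f f≤½ e≈-D =
        ≤-respˡ (+-congˡ (-‿cong (sym (exp-cong e≈-D))))
          (≤-respʳ (sym (Pr≈𝔼 d (λ hs → ℬ S? κ c hs ≤? N))) main)
        where
        d : Dist (Vec (Hash m n) T)
        d = iid T (ℋ f m n)
        H-prob : IsProbability (ℋ f m n)
        H-prob = ℋ-isProbability m n 0≤f f≤½
        d-prob : IsProbability d
        d-prob = iid-isProbability T H-prob
        D : Carrier
        D = (κ ^ 2 * c * fromℕ T) / ((1# + κ) * (2# + κ))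
        good : Vec (Hash m n) T → Carrier
        good hs = 𝟙 (does (ℬ S? κ c hs ≤? N))
        many : Vec (Hash m n) T → Carrier
        many hs = 𝟙 (does (c * fromℕ T ≤? fromℕ (Y S? hs)))
        main : 1# - exp (- D) ≤ 𝔼 d good
        -- Whether the nonzero value of `ℬ` exceeds N is a deterministic question about S. If it
        -- does not, success is certain and `0≤exp` bounds the left side by 1; only the other case
        -- involves Y.
        main with 2# ^ m * c / (1# + κ) ≤? N
        ... | yes bound≤N = begin
          1# - exp (- D)   ≤⟨ +-monoʳ-≤ 1# (neg-antimono-≤ (0≤exp (- D))) ⟩
          1# - 0#          ≈⟨ solve 0 (:1 :- :0 := :1) refl ⟩
          1#               ≈⟨ 𝔼-1 d-prob ⟨
          𝔼 d (λ _ → 1#)   ≤⟨ 𝔼-mono d-prob (λ hs → 1≤good hs) ⟩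
          𝔼 d good         ∎
          where
          1≤good : ∀ hs → 1# ≤ good hs
          1≤good hs with ℬ S? κ c hs ≤? N
          ... | yes _   = ≤-refl
          ... | no  ℬ≰N = contradiction (ℬ-≤ bound≤N hs) ℬ≰N
        ... | no bound≰N = begin
          1# - exp (- D)                     ≤⟨ +-monoʳ-≤ 1# (neg-antimono-≤ (chernoff H-prob (λ h → 1 ℕ.≤? countZeros S? h) T p≤q)) ⟩
          1# - 𝔼 d many                      ≈⟨ +-cong (𝔼-1 d-prob) (solve 1 (λ x → (:- :1) :* x := :- x) refl _) ⟨
          𝔼 d (λ _ → 1#) + - 1# * 𝔼 d many   ≈⟨ +-congˡ (𝔼-*ˡ d (- 1#) many) ⟨
          𝔼 d (λ _ → 1#) + 𝔼 d (λ hs → - 1# * many hs)  ≈⟨ 𝔼-+ d (λ _ → 1#) (λ hs → - 1# * many hs) ⟨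
          𝔼 d (λ hs → 1# + - 1# * many hs)   ≤⟨ 𝔼-mono d-prob (λ hs →
            ≤-respˡ (+-congˡ (solve 1 (λ x → :- x := (:- :1) :* x) refl (many hs))) (failure≤ 1≤T hs)) ⟩
          𝔼 d good                           ∎
          where
          p≤q : Pr (ℋ f m n) (λ h → 1 ℕ.≤? countZeros S? h) ≤ q
          p≤q = begin
            Pr (ℋ f m n) (λ h → 1 ℕ.≤? countZeros S? h)  ≤⟨ Pr-nonempty≤ {m = m} S? 0≤f f≤½ ⟩
            N * ½ ^ m                             ≤⟨ *-monoˡ-≤ (0≤^ (proj₁ 0<½) m) (proj₁ (≰⇒> bound≰N)) ⟩
            2# ^ m * c / (1# + κ) * ½ ^ m         ≈⟨ solve 4 (λ u c w v → u :* c :* w :* v := u :* v :* (c :* w)) refl (2# ^ m) c ((1# + κ) ⁻¹) (½ ^ m) ⟩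
            2# ^ m * ½ ^ m * q                    ≈⟨ *-congʳ (2^*½^≈1 m) ⟩
            1# * q                                ≈⟨ *-identityˡ q ⟩
            q                                     ∎

theorem3 : ∀ {a ℓ₁ ℓ₂ p} (ℝ : RealField a ℓ₁ ℓ₂) →
    let open HashCounting ℝ in
    (m n T : ℕ) → 1 ℕ.≤ m → m ℕ.≤ n → 1 ℕ.≤ T →
    (S : Pred (Bits n) p) (S? : Decidable S) →
    (f κ c : Carrier) → 0# ≤ f → f ≤ ½ → 0# < κ → 0# < c →
    Pr (iid T (ℋ f m n)) (λ hs → ℬ S? κ c hs ≤? fromℕ (card S?))
    ≥ 1# - exp (- ((κ ^ 2 * c * fromℕ T) / ((1# + κ) * (2# + κ))))
theorem3 ℝ m n T _ _ 1≤T S S? f κ c 0≤f f≤½ 0<κ = bound ≡.refl refl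
  where
  open HashCounting ℝ
  open Expectation ℝ
  open Exponential ℝ using (exp-converges)
  -- Comparing instances of exp at exponents that are not syntactically equal
  -- unfolds exp.  Since the result is a function type, Agda first unifies it
  -- with the goal, so that E and then e are copied from there.
  bound : ∀ {E e} → exp e ≡ E → e ≈ - ((κ ^ 2 * c * fromℕ T) / ((1# + κ) * (2# + κ))) →
          0# < c → 1# - E ≤ Pr (iid T (ℋ f m n)) (λ hs → ℬ S? κ c hs ≤? fromℕ (card S?))
  bound ≡.refl e≈-D 0<c = Chernoff.lower-bound exp exp-converges 0<κ 0<c S? 1≤T 0≤f f≤½ e≈-D
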